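{- Let $n$ be even and let $C$ be a locally optimal coloring of $E(K_n)$ that is not a one-factorization. Then there are two vertices $x,y\in[n]$ and a coloring $C'$ that agrees with $C$ on every edge not incident with $x$ or $y$, such that $\Psi(C')<\Psi(C)$. Furthermore, $x,y$ and $C'$ can be found in time polynomial in $n$.
   Context: A coloring is any map $C:E(K_n)\to\{1,\dots,n-1\}$, not necessarily proper; a one-factorization is a proper coloring. For a coloring $C$, vertex $u$ and color $\mu$, $a_{u,\mu}$ is the number of $\mu$-colored edges incident with $u$, and $\Psi(C)=\sum_{u,\mu}\binom{a_{u,\mu}}{2}$. A coloring $C$ is locally optimal if every coloring $C'$ that differs from $C$ on exactly one edge satisfies $\Psi(C')\ge \Psi(C)$. -}

module Defs where

open import Data.Fin using (Fin; _<_; toℕ)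
open import Data.Fin.Properties using (_≟_; _<?_)
open import Data.List using (List; allFin; cartesianProduct; filter; length; mapMaybe)
open import Data.Maybe using (Maybe; just; nothing)
open import Data.Nat as ℕ using (ℕ; zero; suc; _+_; _∸_)
open import Data.Nat.Combinatorics using (_C_)
open import Data.Nat.Properties using (+-*-semiring)
open import Data.Product using (_×_; _,_; ∃-syntax)
open import Data.Sum using (_⊎_)
open import Relation.Binary.PropositionalEquality using (_≡_; _≢_)
open import Relation.Nullary using (¬_; Dec; yes; no; _×-dec_; _⊎-dec_)

open import Algebra.Properties.Semiring.Sum +-*-semiring using (sum-syntax)

-- The vertices of K_n are Fin n; an edge, i.e. a two-element set of vertices,
-- is listed in increasing order.
record Edge (n : ℕ) : Set where
  constructor mkEdge
  field
    lo hi    : Fin n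
    .ordered : lo < hi

open Edge public

infix 4 _∈ᵉ_ _∉ᵉ_ _∈ᵉ?_

_∈ᵉ_ : ∀ {n} → Fin n → Edge n → Set
u ∈ᵉ e = (u ≡ lo e) ⊎ (u ≡ hi e)

_∉ᵉ_ : ∀ {n} → Fin n → Edge n → Set
u ∉ᵉ e = ¬ (u ∈ᵉ e)

_∈ᵉ?_ : ∀ {n} (u : Fin n) (e : Edge n) → Dec (u ∈ᵉ e)
u ∈ᵉ? e = (u ≟ lo e) ⊎-dec (u ≟ hi e)

edges : ∀ n → List (Edge n)
edges n = mapMaybe toEdge (cartesianProduct (allFin n) (allFin n))
  where
  toEdge : Fin n × Fin n → Maybe (Edge n)
  toEdge (u , v) with u <? v
  ... | yes u<v = just (mkEdge u v u<v)
  ... | no  _   = nothing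

-- The colours 1, …, n-1 are represented by 0, …, n-2.
Colour : ℕ → Set
Colour n = Fin (n ∸ 1)

Coloring : ℕ → Set
Coloring n = Edge n → Colour n

colourDegree : ∀ {n} → Coloring n → Fin n → Colour n → ℕ
colourDegree {n} c u μ =
  length (filter (λ e → (u ∈ᵉ? e) ×-dec (c e ≟ μ)) (edges n))

Ψ : ∀ {n} → Coloring n → ℕ
Ψ {n} c = ∑[ u < n ] ∑[ μ < n ∸ 1 ] (colourDegree c u μ C 2)

IsOneFactorization : ∀ {n} → Coloring n → Set
IsOneFactorization {n} c =
  ∀ (u : Fin n) (e f : Edge n) → u ∈ᵉ e → u ∈ᵉ f → c e ≡ c f → e ≡ f

DiffersOnExactlyOneEdge : ∀ {n} → Coloring n → Coloring n → Set
DiffersOnExactlyOneEdge {n} c′ c =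
  ∃[ e ] (c′ e ≢ c e × (∀ (f : Edge n) → f ≢ e → c′ f ≡ c f))

LocallyOptimal : ∀ {n} → Coloring n → Set
LocallyOptimal {n} c =
  ∀ (c′ : Coloring n) → DiffersOnExactlyOneEdge c′ c → Ψ c′ ℕ.≥ Ψ c

-- c′ may differ from c only on edges incident with x or y, including xy.
record TwoVertexImprovement {n} (c : Coloring n) (x y : Fin n) (c′ : Coloring n) : Set where
  field
    distinct : x ≢ y
    agrees   : ∀ (e : Edge n) → x ∉ᵉ e → y ∉ᵉ e → c′ e ≡ c e
    improves : Ψ c′ ℕ.< Ψ c

-- Time is measured on the following model of computation: imperative programs
-- over natural-number variables and two-dimensional arrays with computed
-- indices, i.e. structured random access machines, in which every operation
-- takes unit time.  Addition and truncated subtraction are the only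
-- arithmetic, so one operation lengthens the largest number in the store by at
-- most one bit, and polynomially many steps amount to polynomially many bit
-- operations.  (Unit-cost multiplication would break this.)

data Expr : Set where
  lit       : ℕ → Expr
  var       : ℕ → Expr
  arr       : ℕ → Expr → Expr → Expr
  _⊕_ _⊖_   : Expr → Expr → Expr

infixl 6 _⊕_ _⊖_

data Program : Set where
  skip          : Program
  setVar        : ℕ → Expr → Program
  setArr        : ℕ → Expr → Expr → Expr → Program
  _⨾_           : Program → Program → Program
  ifNonZero     : Expr → Program → Program → Program
  whileNonZero  : Expr → Program → Program

infixr 5 _⨾_

record Store : Set where
  constructor mkStore
  field
    vars : ℕ → ℕ
    arrs : ℕ → ℕ → ℕ → ℕ

open Store public

⟦_⟧ : Expr → Store → ℕ
⟦ lit k ⟧     s = k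
⟦ var x ⟧     s = vars s x
⟦ arr a i j ⟧ s = arrs s a (⟦ i ⟧ s) (⟦ j ⟧ s)
⟦ d ⊕ e ⟧     s = ⟦ d ⟧ s + ⟦ e ⟧ s
⟦ d ⊖ e ⟧     s = ⟦ d ⟧ s ∸ ⟦ e ⟧ s

-- Evaluation time.
cost : Expr → ℕ
cost (lit k)     = 1
cost (var x)     = 1
cost (arr a i j) = 1 + cost i + cost j
cost (d ⊕ e)     = 1 + cost d + cost e
cost (d ⊖ e)     = 1 + cost d + cost e

writeVar : ℕ → ℕ → Store → Store
writeVar x v s = mkStore vars′ (arrs s)
  where
  vars′ : ℕ → ℕ
  vars′ y with y ℕ.≟ x
  ... | yes _ = v
  ... | no  _ = vars s y

writeArr : ℕ → ℕ → ℕ → ℕ → Store → Store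
writeArr a i j v s = mkStore (vars s) arrs′
  where
  arrs′ : ℕ → ℕ → ℕ → ℕ
  arrs′ b k l with (b ℕ.≟ a) ×-dec (k ℕ.≟ i) ×-dec (l ℕ.≟ j)
  ... | yes _ = v
  ... | no  _ = arrs s b k l

infix 4 ⟨_,_⟩⇓[_]_

-- ⟨ p , s ⟩⇓[ t ] s′: started in s, the program p halts in s′ after time t.
data ⟨_,_⟩⇓[_]_ : Program → Store → ℕ → Store → Set where
  skip⇓   : ∀ {s} → ⟨ skip , s ⟩⇓[ 1 ] s
  setVar⇓ : ∀ {s x e} →
            ⟨ setVar x e , s ⟩⇓[ 1 + cost e ] writeVar x (⟦ e ⟧ s) s
  setArr⇓ : ∀ {s a i j e} →
            ⟨ setArr a i j e , s ⟩⇓[ 1 + cost i + cost j + cost e ]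
              writeArr a (⟦ i ⟧ s) (⟦ j ⟧ s) (⟦ e ⟧ s) s
  ⨾⇓      : ∀ {s s′ s″ p q t t′} →
            ⟨ p , s ⟩⇓[ t ] s′ → ⟨ q , s′ ⟩⇓[ t′ ] s″ →
            ⟨ p ⨾ q , s ⟩⇓[ t + t′ ] s″
  then⇓   : ∀ {s s′ e p q t} → ⟦ e ⟧ s ≢ 0 → ⟨ p , s ⟩⇓[ t ] s′ →
            ⟨ ifNonZero e p q , s ⟩⇓[ 1 + cost e + t ] s′
  else⇓   : ∀ {s s′ e p q t} → ⟦ e ⟧ s ≡ 0 → ⟨ q , s ⟩⇓[ t ] s′ →
            ⟨ ifNonZero e p q , s ⟩⇓[ 1 + cost e + t ] s′
  loop⇓   : ∀ {s s′ s″ e p t t′} → ⟦ e ⟧ s ≢ 0 →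
            ⟨ p , s ⟩⇓[ t ] s′ → ⟨ whileNonZero e p , s′ ⟩⇓[ t′ ] s″ →
            ⟨ whileNonZero e p , s ⟩⇓[ 1 + cost e + t + t′ ] s″
  exit⇓   : ∀ {s e p} → ⟦ e ⟧ s ≡ 0 →
            ⟨ whileNonZero e p , s ⟩⇓[ 1 + cost e ] s

-- Variable 0 holds n and array 0 holds the colours as a symmetric matrix; the
-- rest of the store is unconstrained, so a program must not rely on it being
-- zero (nor on anything else stored there).
record Holds {n} (c : Coloring n) (s : Store) : Set where
  field
    size   : vars s 0 ≡ n
    colour : ∀ (e : Edge n) → arrs s 0 (toℕ (lo e)) (toℕ (hi e)) ≡ toℕ (c e)
    mirror : ∀ (e : Edge n) → arrs s 0 (toℕ (hi e)) (toℕ (lo e)) ≡ toℕ (c e)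

-- The result is left in variables 1 and 2 and, in place of c, in array 0.
record OutputsImprovement {n} (c : Coloring n) (s : Store) : Set where
  field
    x y         : Fin n
    c′          : Coloring n
    improvement : TwoVertexImprovement c x y c′
    x-stored    : vars s 1 ≡ toℕ x
    y-stored    : vars s 2 ≡ toℕ y
    c′-stored   : Holds c′ s

-- Exchanging the colours of xw and yw changes no degree except at x and y.  Let
-- κ occur at least twice at x and never at y.  Exchange along a trail: at each
-- step pick an unused w such that xw has the current colour (κ at first), and
-- let the old colour of yw become the current one.  Counting shows that the
-- trail can be continued while the current colour is at least as frequent at x
-- as at y; when it stops, κ has become better balanced between x and y and no
-- colour is worse balanced, so Ψ has dropped.
--
-- It remains to find x, y and κ.  A vertex u with a repeated colour misses some
-- colour ν.  As n is even, ν cannot have degree one at all other vertices.  A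
-- vertex repeating ν forms a suitable pair with u.  Otherwise let y miss ν as
-- well, and let uz have a colour repeated at u.  Local optimality forces ν to
-- occur at z; if it is repeated there, take z and y.  If it occurs once, recolour
-- uz with ν, which does not increase Ψ, and again take z and y.

module Submission where

open import Defs
open import Algebra.Properties.Semiring.Sum using (sum-syntax; sum-cong-≗; sum-init-last)
open import Data.Fin as Fin using (Fin; toℕ; fromℕ<)
open import Data.Fin.Properties as Fin using (toℕ<n; toℕ-injective; toℕ-fromℕ<; toℕ-fromℕ; toℕ-inject₁; fromℕ<-toℕ)
open import Data.List using (List; []; _∷_; _++_; length; filter; mapMaybe; map; tabulate; allFin; cartesianProduct; cartesianProductWith)
open import Data.List.Properties using (length-++; filter-++; mapMaybe-++)
open import Data.Maybe using (Maybe; just; nothing)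
open import Data.Nat
open import Data.Nat.Combinatorics using (_C_; nC1≡n; nCk+nC[k+1]≡[n+1]C[k+1])
open import Data.Nat.Divisibility using (_∣_; _∣0; ∣m∣n⇒∣m+n; ∣m+n∣m⇒∣n; m∣m*n; ∣1⇒≡1)
open import Data.Nat.Properties
open import Data.Nat.Tactic.RingSolver using (solve-∀)
open import Data.Product using (_×_; _,_; proj₁; proj₂; ∃-syntax)
open import Data.Sum using (_⊎_; inj₁; inj₂; [_,_]′)
open import Data.Unit using (⊤)
open import Function using (_∘_; id)
open import Relation.Binary.Definitions using (tri<; tri≈; tri>)
open import Relation.Binary.PropositionalEquality
open import Relation.Nullary using (¬_; Dec; yes; no; contradiction; _×-dec_; _⊎-dec_; ¬?; recompute)
open import Relation.Nullary.Decidable using (False; toWitnessFalse)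
open import Relation.Unary using (Decidable)

-- Finite sums

-- Intermediate colours cancel along the trail: a step gives `x` the colour that the next step takes
-- from it again, and dually at `y`. However long the trail, its net effect is that one edge of the
-- first colour passes from `x` to `y` and one edge of the last colour from `y` to `x`. Hence the
-- stopping test can compare the degrees from before the trail, and the gain is convexity of
-- `k C 2`. Changes of degree are stated as `b + δ μ κ ≡ a + δ ν κ`, which avoids subtraction and
-- composes by cancellation. Colourings are handled as matrices over all natural numbers, because
-- array 0 of a store is one; its diagonal and the entries out of range are arbitrary, so degrees
-- ignore them. Both halves of the theorem come from one program: existence is obtained by running
-- it on a store built from the colouring. The case distinction behind `x`, `y` and `κ` only proves
-- that a candidate exists; the program finds one by exhaustive search.

sumBelow : ℕ → (ℕ → ℕ) → ℕ
sumBelow zero    f = 0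
sumBelow (suc n) f = sumBelow n f + f n

sum-cong : ∀ n {f g} → (∀ i → i < n → f i ≡ g i) → sumBelow n f ≡ sumBelow n g
sum-cong zero    eq = refl
sum-cong (suc n) eq =
  cong₂ _+_ (sum-cong n λ i i<n → eq i (m<n⇒m<1+n i<n)) (eq n (n<1+n n))

sum-mono : ∀ n {f g} → (∀ i → i < n → f i ≤ g i) → sumBelow n f ≤ sumBelow n g
sum-mono zero    le = z≤n
sum-mono (suc n) le =
  +-mono-≤ (sum-mono n λ i i<n → le i (m<n⇒m<1+n i<n)) (le n (n<1+n n))

sum-mono-< : ∀ n {f g} k → k < n → (∀ i → i < n → f i ≤ g i) → f k < g k →
             sumBelow n f < sumBelow n g
sum-mono-< (suc n) k k<1+n le lt with k ≟ n
... | yes refl = +-mono-≤-< (sum-mono n λ i i<n → le i (m<n⇒m<1+n i<n)) lt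
... | no  k≢n  =
  +-mono-<-≤ (sum-mono-< n k (≤∧≢⇒< (s≤s⁻¹ k<1+n) k≢n)
                (λ i i<n → le i (m<n⇒m<1+n i<n)) lt)
             (le n (n<1+n n))

sum-const : ∀ n k → sumBelow n (λ _ → k) ≡ n * k
sum-const zero    k = refl
sum-const (suc n) k = trans (+-comm _ k) (cong (k +_) (sum-const n k))

sum-zero : ∀ n {f} → (∀ i → i < n → f i ≡ 0) → sumBelow n f ≡ 0
sum-zero n f≡0 = trans (sum-cong n f≡0) (trans (sum-const n 0) (*-zeroʳ n))

interchange : ∀ a b c d → (a + b) + (c + d) ≡ (a + c) + (b + d)
interchange = solve-∀

sum-+ : ∀ n f g → sumBelow n (λ i → f i + g i) ≡ sumBelow n f + sumBelow n g
sum-+ zero    f g = refl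
sum-+ (suc n) f g =
  trans (cong (_+ (f n + g n)) (sum-+ n f g))
        (interchange (sumBelow n f) (sumBelow n g) (f n) (g n))

sum-swap : ∀ m n (f : ℕ → ℕ → ℕ) →
           sumBelow m (λ i → sumBelow n (f i)) ≡ sumBelow n (λ j → sumBelow m λ i → f i j)
sum-swap zero    n f = sym (sum-zero n λ _ _ → refl)
sum-swap (suc m) n f =
  trans (cong (_+ sumBelow n (f m)) (sum-swap m n f)) (sym (sum-+ n _ (f m)))

sum-pos : ∀ n {f} → 0 < sumBelow n f → ∃[ i ] (i < n × 0 < f i)
sum-pos (suc n) {f} pos with f n in fn≡
... | suc k = n , n<1+n n , ≤-trans (s≤s z≤n) (≤-reflexive (sym fn≡))
... | zero  =
  let i , i<n , fi = sum-pos n (subst (0 <_) (+-identityʳ _) pos)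
  in  i , m<n⇒m<1+n i<n , fi

private
  shift : ∀ s t a → (s + t) + a ≡ (s + a) + t
  shift = solve-∀

-- The summands `a` and `b` record the change at the single index `k` without subtraction;
-- recolouring an entry, blocking it and deleting a term are all instances.
sum-replace : ∀ n {f g a b} k → k < n → (∀ i → i < n → i ≢ k → f i ≡ g i) →
              f k + a ≡ g k + b → sumBelow n f + a ≡ sumBelow n g + b
sum-replace (suc n) {f} {g} {a} {b} k k<1+n off at with k ≟ n
... | yes refl =
  trans (+-assoc (sumBelow n f) (f n) a)
    (trans (cong₂ _+_ (sum-cong n λ i i<n → off i (m<n⇒m<1+n i<n) (<⇒≢ i<n)) at)
      (sym (+-assoc (sumBelow n g) (g n) b)))
... | no  k≢n  =
  trans (shift (sumBelow n f) (f n) a)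
    (trans (cong₂ _+_ (sum-replace n k (≤∧≢⇒< (s≤s⁻¹ k<1+n) k≢n)
                         (λ i i<n → off i (m<n⇒m<1+n i<n)) at)
                      (off n (n<1+n n) (k≢n ∘ sym)))
      (sym (shift (sumBelow n g) (g n) b)))

sum-single : ∀ n {f} k → k < n → (∀ i → i < n → i ≢ k → f i ≡ 0) → sumBelow n f ≡ f k
sum-single n {f} k k<n off =
  trans (sym (+-identityʳ _))
    (trans (sum-replace n {g = λ _ → 0} {b = f k} k k<n off (+-identityʳ (f k)))
           (cong (_+ f k) (sum-zero n λ _ _ → refl)))

-- Only addition and truncated subtraction occur in these indicators, so that
-- programs can evaluate them.

dist : ℕ → ℕ → ℕ
dist a b = (a ∸ b) + (b ∸ a)

dist-self : ∀ a → dist a a ≡ 0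
dist-self a = cong₂ _+_ (n∸n≡0 a) (n∸n≡0 a)

dist≡0⇒≡ : ∀ {a b} → dist a b ≡ 0 → a ≡ b
dist≡0⇒≡ {a} {b} eq =
  ≤-antisym (m∸n≡0⇒m≤n (m+n≡0⇒m≡0 (a ∸ b) eq)) (m∸n≡0⇒m≤n (m+n≡0⇒n≡0 (a ∸ b) eq))

≡⇒dist≡0 : ∀ {a b} → a ≡ b → dist a b ≡ 0
≡⇒dist≡0 {a} refl = dist-self a

≢⇒0<dist : ∀ {a b} → a ≢ b → 0 < dist a b
≢⇒0<dist a≢b = n≢0⇒n>0 (a≢b ∘ dist≡0⇒≡)

opaque

  δ : ℕ → ℕ → ℕ
  δ a b = 1 ∸ dist a b

  δ-unfold : ∀ a b → δ a b ≡ 1 ∸ dist a b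
  δ-unfold a b = refl

  δ-≡ : ∀ {a b} → a ≡ b → δ a b ≡ 1
  δ-≡ a≡b = cong (1 ∸_) (≡⇒dist≡0 a≡b)

  δ-≢ : ∀ {a b} → a ≢ b → δ a b ≡ 0
  δ-≢ a≢b = m≤n⇒m∸n≡0 (≢⇒0<dist a≢b)

  δ-comm : ∀ a b → δ a b ≡ δ b a
  δ-comm a b = cong (1 ∸_) (+-comm (a ∸ b) (b ∸ a))

δ≡0⇒≢ : ∀ {a b} → δ a b ≡ 0 → a ≢ b
δ≡0⇒≢ eq a≡b = 1+n≢0 (trans (sym (δ-≡ a≡b)) eq)

opaque
  unfolding δ

  -- The first argument is a number that means "free" only when it is zero. It can thus be `δ u v`,
  -- which excludes the diagonal from a degree, as well as a mark of the trail.
  slot : ℕ → ℕ → ℕ → ℕ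
  slot blocked μ κ = 1 ∸ (blocked + dist μ κ)

  slot-unfold : ∀ u v μ κ → slot (δ u v) μ κ ≡ 1 ∸ ((1 ∸ dist u v) + dist μ κ)
  slot-unfold u v μ κ = refl

  slot-blocked : ∀ {k} μ κ → k ≢ 0 → slot k μ κ ≡ 0
  slot-blocked {k} μ κ k≢0 = m≤n⇒m∸n≡0 (≤-trans (n≢0⇒n>0 k≢0) (m≤m+n k (dist μ κ)))

  slot-free : ∀ {k} μ κ → k ≡ 0 → slot k μ κ ≡ δ μ κ
  slot-free μ κ refl = refl

  slot-pos : ∀ {k μ κ} → 0 < slot k μ κ → k ≡ 0 × μ ≡ κ
  slot-pos {k} {μ} {κ} pos with k + dist μ κ in eq
  ... | zero  = m+n≡0⇒m≡0 k eq , dist≡0⇒≡ (m+n≡0⇒n≡0 k eq)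
  ... | suc m = contradiction pos (<-irrefl (sym (0∸n≡0 m)))

-- Counting the free entries of a given colour in a row

count : ℕ → (ℕ → ℕ) → (ℕ → ℕ) → ℕ → ℕ
count n blocked row κ = sumBelow n λ v → slot (blocked v) (row v) κ

count-pos : ∀ n {blocked row κ} → 0 < count n blocked row κ →
            ∃[ v ] (v < n × blocked v ≡ 0 × row v ≡ κ)
count-pos n pos = let v , v<n , s = sum-pos n pos in v , v<n , slot-pos s

count-cong : ∀ n {bl bl′ row row′ : ℕ → ℕ} {κ} → (∀ v → v < n → bl v ≡ bl′ v) →
             (∀ v → v < n → bl′ v ≡ 0 → row v ≡ row′ v) →
             count n bl row κ ≡ count n bl′ row′ κ
count-cong n {bl} {bl′} {row} {row′} {κ} bl≡ row≡ = sum-cong n same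
  where
  same : ∀ v → v < n → slot (bl v) (row v) κ ≡ slot (bl′ v) (row′ v) κ
  same v v<n with bl′ v ≟ 0
  ... | yes free = cong₂ (λ k μ → slot k μ κ) (bl≡ v v<n) (row≡ v v<n free)
  ... | no  full = trans (slot-blocked _ κ (full ∘ trans (sym (bl≡ v v<n))))
                         (sym (slot-blocked _ κ full))

count-recolour : ∀ n {bl row row′ : ℕ → ℕ} {κ} k → k < n → bl k ≡ 0 →
                 (∀ v → v < n → v ≢ k → row′ v ≡ row v) →
                 count n bl row′ κ + δ (row k) κ ≡ count n bl row κ + δ (row′ k) κ
count-recolour n {bl} {row} {row′} {κ} k k<n free off =
  sum-replace n k k<n (λ v v<n v≢k → cong (λ μ → slot (bl v) μ κ) (off v v<n v≢k))
    (trans (cong (_+ δ (row k) κ) (slot-free (row′ k) κ free))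
      (trans (+-comm (δ (row′ k) κ) _)
        (cong (_+ δ (row′ k) κ) (sym (slot-free (row k) κ free)))))

-- The entry at `k` may change arbitrarily, since it is blocked afterwards; a trail step can
-- therefore recolour the edge to `w` and mark `w` at once.
count-block : ∀ n {bl bl′ row row′ : ℕ → ℕ} {κ} k → k < n → bl k ≡ 0 → bl′ k ≢ 0 →
              (∀ v → v < n → v ≢ k → bl′ v ≡ bl v) →
              (∀ v → v < n → v ≢ k → bl v ≡ 0 → row′ v ≡ row v) →
              count n bl′ row′ κ + δ (row k) κ ≡ count n bl row κ
count-block n {bl} {bl′} {row} {row′} {κ} k k<n free full bl-off row-off =
  trans (sum-replace n k k<n off at) (+-identityʳ _)
  where
  off : ∀ v → v < n → v ≢ k → slot (bl′ v) (row′ v) κ ≡ slot (bl v) (row v) κ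
  off v v<n v≢k with bl v ≟ 0
  ... | yes fr = cong₂ (λ b μ → slot b μ κ) (bl-off v v<n v≢k) (row-off v v<n v≢k fr)
  ... | no  fu = trans (slot-blocked _ κ (fu ∘ trans (sym (bl-off v v<n v≢k))))
                       (sym (slot-blocked _ κ fu))

  at : slot (bl′ k) (row′ k) κ + δ (row k) κ ≡ slot (bl k) (row k) κ + 0
  at = trans (cong (_+ δ (row k) κ) (slot-blocked _ κ full))
         (trans (sym (slot-free (row k) κ free)) (sym (+-identityʳ _)))

-- Sums split at two indices

others : ℕ → ℕ → (ℕ → ℕ) → ℕ → ℕ
others x y f u = (1 ∸ (δ u x + δ u y)) * f u

others-here : ∀ x y f u → u ≡ x ⊎ u ≡ y → others x y f u ≡ 0
others-here x y f u (inj₁ u≡x) =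
  cong (_* f u) (m≤n⇒m∸n≡0 (≤-trans (≤-reflexive (sym (δ-≡ u≡x))) (m≤m+n (δ u x) (δ u y))))
others-here x y f u (inj₂ u≡y) =
  cong (_* f u) (m≤n⇒m∸n≡0 (≤-trans (≤-reflexive (sym (δ-≡ u≡y))) (m≤n+m (δ u y) (δ u x))))

others-away : ∀ {x y} f {u} → u ≢ x → u ≢ y → others x y f u ≡ f u
others-away f {u} u≢x u≢y =
  trans (cong₂ (λ k l → (1 ∸ (k + l)) * f u) (δ-≢ u≢x) (δ-≢ u≢y)) (+-identityʳ (f u))

sum-split : ∀ n f {x y} → x < n → y < n → x ≢ y →
            sumBelow n f ≡ sumBelow n (others x y f) + (f x + f y)
sum-split n f {x} {y} x<n y<n x≢y =
  trans (sym (+-identityʳ _))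
    (trans (sum-replace n {g = h} {b = f x} x x<n off-x at-x)
      (trans (cong (_+ f x) (trans (sym (+-identityʳ _)) (sum-replace n {b = f y} y y<n off-y at-y)))
        (rearrange (sumBelow n (others x y f)) (f x) (f y))))
  where
  h : ℕ → ℕ
  h u = (1 ∸ δ u x) * f u

  rearrange : ∀ a b c → (a + c) + b ≡ a + (b + c)
  rearrange = solve-∀

  off-x : ∀ i → i < n → i ≢ x → f i ≡ h i
  off-x i _ i≢x = sym (trans (cong (λ k → (1 ∸ k) * f i) (δ-≢ i≢x)) (+-identityʳ _))

  at-x : f x + 0 ≡ h x + f x
  at-x = trans (+-identityʳ _) (cong (λ k → (1 ∸ k) * f x + f x) (sym (δ-≡ {x} refl)))

  off-y : ∀ i → i < n → i ≢ y → h i ≡ others x y f i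
  off-y i _ i≢y =
    cong (λ k → (1 ∸ k) * f i) (trans (sym (+-identityʳ _)) (cong (δ i x +_) (sym (δ-≢ i≢y))))

  at-y : h y + 0 ≡ others x y f y + f y
  at-y = trans (+-identityʳ _)
    (trans (sym (off-x y y<n (x≢y ∘ sym))) (cong (_+ f y) (sym (others-here x y f y (inj₂ refl)))))

module _ (n : ℕ) {f g : ℕ → ℕ} {x y : ℕ} (x<n : x < n) (y<n : y < n) (x≢y : x ≢ y)
         (away : ∀ u → u < n → u ≢ x → u ≢ y → f u ≤ g u) where

  private
    others-≤ : ∀ u → u < n → others x y f u ≤ others x y g u
    others-≤ u u<n with u ≟ x | u ≟ y
    ... | yes u≡x | _       = ≤-trans (≤-reflexive (others-here x y f u (inj₁ u≡x))) z≤n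
    ... | no  _   | yes u≡y = ≤-trans (≤-reflexive (others-here x y f u (inj₂ u≡y))) z≤n
    ... | no  u≢x | no  u≢y =
      subst₂ _≤_ (sym (others-away f u≢x u≢y)) (sym (others-away g u≢x u≢y)) (away u u<n u≢x u≢y)

  -- A strict drop can come from `x` and `y` taken together or, in `sum-away-<`, from a third
  -- vertex. These are the two kinds of `Selected`.
  sum-pair-< : f x + f y < g x + g y → sumBelow n f < sumBelow n g
  sum-pair-< lt =
    subst₂ _<_ (sym (sum-split n f x<n y<n x≢y)) (sym (sum-split n g x<n y<n x≢y))
      (+-mono-≤-< (sum-mono n others-≤) lt)

  sum-away-< : f x + f y ≤ g x + g y → ∀ z → z < n → z ≢ x → z ≢ y → f z < g z →
               sumBelow n f < sumBelow n g
  sum-away-< le z z<n z≢x z≢y lt =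
    subst₂ _<_ (sym (sum-split n f x<n y<n x≢y)) (sym (sum-split n g x<n y<n x≢y))
      (+-mono-<-≤ (sum-mono-< n z z<n others-≤
                    (subst₂ _<_ (sym (others-away f z≢x z≢y)) (sym (others-away g z≢x z≢y)) lt))
                  le)

-- Colour matrices

Matrix : Set
Matrix = ℕ → ℕ → ℕ

degree : ℕ → Matrix → ℕ → ℕ → ℕ
degree n M u = count n (δ u) (M u)

energy : ℕ → Matrix → ℕ
energy n M = sumBelow n λ u → sumBelow (n ∸ 1) λ κ → degree n M u κ C 2

-- Only off-diagonal entries in range are constrained, since a store may hold anything elsewhere.
record Valid (n : ℕ) (M : Matrix) : Set where
  field
    symmetric : ∀ {i j} → i < n → j < n → i ≢ j → M i j ≡ M j i
    bounded   : ∀ {i j} → i < n → j < n → i ≢ j → M i j < n ∸ 1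

open Valid

degree-cong : ∀ n {M N : Matrix} → (∀ i j → N i j ≡ M i j) → ∀ u κ → degree n N u κ ≡ degree n M u κ
degree-cong n N≡M u κ = count-cong n (λ _ _ → refl) (λ v _ _ → N≡M u v)

neighbour : ∀ n {M u κ} → 0 < degree n M u κ → ∃[ v ] (v < n × u ≢ v × M u v ≡ κ)
neighbour n pos = let v , v<n , free , col = count-pos n pos in v , v<n , δ≡0⇒≢ free , col

-- A relation instead of a function, because it has to hold both of `recolour` and of the array that
-- a program leaves behind.
record Recoloured (x z ν : ℕ) (M M′ : Matrix) : Set where
  field
    forth     : M′ x z ≡ ν
    back      : M′ z x ≡ ν
    elsewhere : ∀ i j → ¬ (i ≡ x × j ≡ z) → ¬ (i ≡ z × j ≡ x) → M′ i j ≡ M i j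

open Recoloured

flip-recoloured : ∀ {x z ν M M′} → Recoloured x z ν M M′ → Recoloured z x ν M M′
flip-recoloured r = record
  { forth = back r ; back = forth r ; elsewhere = λ i j ≢zx ≢xz → elsewhere r i j ≢xz ≢zx }

recoloured-degree-end : ∀ n {x z ν M M′} → z < n → x ≢ z → Recoloured x z ν M M′ →
  ∀ κ → degree n M′ x κ + δ (M x z) κ ≡ degree n M x κ + δ ν κ
recoloured-degree-end n {x} {z} {M = M} {M′} z<n x≢z r κ =
  trans (count-recolour n {row = M x} {row′ = M′ x} z z<n (δ-≢ x≢z)
          (λ v _ v≢z → elsewhere r x v (v≢z ∘ proj₂) (x≢z ∘ proj₁)))
        (cong (λ μ → degree n M x κ + δ μ κ) (forth r))

recoloured-degree-away : ∀ n {x z ν M M′} → Recoloured x z ν M M′ →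
  ∀ {u} → u ≢ x → u ≢ z → ∀ κ → degree n M′ u κ ≡ degree n M u κ
recoloured-degree-away n r {u} u≢x u≢z κ =
  count-cong n (λ _ _ → refl) (λ v _ _ → elsewhere r u v (u≢x ∘ proj₁) (u≢z ∘ proj₁))

recoloured-valid : ∀ {n x z ν M M′} → Valid n M → ν < n ∸ 1 → Recoloured x z ν M M′ → Valid n M′
recoloured-valid {n} {x} {z} {ν} {M} {M′} V ν< r = record { symmetric = sym′ ; bounded = bnd′ }
  where
  sym′ : ∀ {i j} → i < n → j < n → i ≢ j → M′ i j ≡ M′ j i
  sym′ {i} {j} i<n j<n i≢j with (i ≟ x) ×-dec (j ≟ z) | (i ≟ z) ×-dec (j ≟ x)
  ... | yes (refl , refl) | _ = trans (forth r) (sym (back r))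
  ... | no _ | yes (refl , refl) = trans (back r) (sym (forth r))
  ... | no ≢xz | no ≢zx =
    trans (elsewhere r i j ≢xz ≢zx)
      (trans (symmetric V i<n j<n i≢j)
        (sym (elsewhere r j i (λ (p , q) → ≢zx (q , p)) (λ (p , q) → ≢xz (q , p)))))

  bnd′ : ∀ {i j} → i < n → j < n → i ≢ j → M′ i j < n ∸ 1
  bnd′ {i} {j} i<n j<n i≢j with (i ≟ x) ×-dec (j ≟ z) | (i ≟ z) ×-dec (j ≟ x)
  ... | yes (refl , refl) | _ = subst (_< n ∸ 1) (sym (forth r)) ν<
  ... | no _ | yes (refl , refl) = subst (_< n ∸ 1) (sym (back r)) ν<
  ... | no ≢xz | no ≢zx = subst (_< n ∸ 1) (sym (elsewhere r i j ≢xz ≢zx)) (bounded V i<n j<n i≢j)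

recolour : ℕ → ℕ → ℕ → Matrix → Matrix
recolour x z ν M i j with ((i ≟ x) ×-dec (j ≟ z)) ⊎-dec ((i ≟ z) ×-dec (j ≟ x))
... | yes _ = ν
... | no  _ = M i j

recolour-recoloured : ∀ x z ν M → Recoloured x z ν M (recolour x z ν M)
recolour-recoloured x z ν M = record { forth = fo ; back = ba ; elsewhere = el }
  where
  fo : recolour x z ν M x z ≡ ν
  fo with ((x ≟ x) ×-dec (z ≟ z)) ⊎-dec ((x ≟ z) ×-dec (z ≟ x))
  ... | yes _ = refl
  ... | no ne = contradiction (inj₁ (refl , refl)) ne

  ba : recolour x z ν M z x ≡ ν
  ba with ((z ≟ x) ×-dec (x ≟ z)) ⊎-dec ((z ≟ z) ×-dec (x ≟ x))
  ... | yes _ = refl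
  ... | no ne = contradiction (inj₂ (refl , refl)) ne

  el : ∀ i j → ¬ (i ≡ x × j ≡ z) → ¬ (i ≡ z × j ≡ x) → recolour x z ν M i j ≡ M i j
  el i j ≢xz ≢zx with ((i ≟ x) ×-dec (j ≟ z)) ⊎-dec ((i ≟ z) ×-dec (j ≟ x))
  ... | yes (inj₁ e) = contradiction e ≢xz
  ... | yes (inj₂ e) = contradiction e ≢zx
  ... | no _ = refl

-- Convexity of `k C 2` and the effect of recolouring one edge

C2-suc : ∀ k → suc k C 2 ≡ k + k C 2
C2-suc k = trans (sym (nCk+nC[k+1]≡[n+1]C[k+1] k 1)) (cong (_+ k C 2) (nC1≡n k))

C2-step : ∀ k → k C 2 ≤ suc k C 2
C2-step k = ≤-trans (m≤n+m (k C 2) k) (≤-reflexive (sym (C2-suc k)))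

C2-step-< : ∀ {k} → 1 ≤ k → k C 2 < suc k C 2
C2-step-< {k} 1≤k = ≤-trans (+-monoˡ-≤ (k C 2) 1≤k) (≤-reflexive (sym (C2-suc k)))

private
  expandʳ : ∀ r s t → s + (r + t) ≡ r + (s + t)
  expandʳ = solve-∀

-- By `C2-suc` both sides contain `q C 2 + r C 2`; what remains is `q` on the left and `r` on the
-- right.
C2-move-≤ : ∀ {q r} → q ≤ r → suc q C 2 + r C 2 ≤ q C 2 + suc r C 2
C2-move-≤ {q} {r} q≤r = subst₂ _≤_
  (sym (trans (cong (_+ r C 2) (C2-suc q)) (+-assoc q (q C 2) (r C 2))))
  (sym (trans (cong (q C 2 +_) (C2-suc r)) (expandʳ r (q C 2) (r C 2))))
  (+-monoˡ-≤ (q C 2 + r C 2) q≤r)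

C2-move-< : ∀ {q r} → q < r → suc q C 2 + r C 2 < q C 2 + suc r C 2
C2-move-< {q} {r} q<r = subst₂ _<_
  (sym (trans (cong (_+ r C 2) (C2-suc q)) (+-assoc q (q C 2) (r C 2))))
  (sym (trans (cong (q C 2 +_) (C2-suc r)) (expandʳ r (q C 2) (r C 2))))
  (+-monoˡ-< (q C 2 + r C 2) q<r)

module _ {a b : ℕ} where

  unit-same : ∀ {μ ν κ} → b + δ μ κ ≡ a + δ ν κ → μ ≢ κ → ν ≢ κ → b ≡ a
  unit-same eq μ≢κ ν≢κ =
    +-cancelʳ-≡ 0 b a (subst₂ (λ k l → b + k ≡ a + l) (δ-≢ μ≢κ) (δ-≢ ν≢κ) eq)

  unit-lost : ∀ {μ ν κ} → b + δ μ κ ≡ a + δ ν κ → μ ≡ κ → ν ≢ κ → suc b ≡ a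
  unit-lost eq μ≡κ ν≢κ =
    trans (+-comm 1 b)
      (trans (subst₂ (λ k l → b + k ≡ a + l) (δ-≡ μ≡κ) (δ-≢ ν≢κ) eq) (+-identityʳ a))

  unit-gained : ∀ {μ ν κ} → b + δ μ κ ≡ a + δ ν κ → μ ≢ κ → ν ≡ κ → b ≡ suc a
  unit-gained eq μ≢κ ν≡κ =
    trans (sym (+-identityʳ b))
      (trans (subst₂ (λ k l → b + k ≡ a + l) (δ-≢ μ≢κ) (δ-≡ ν≡κ) eq) (+-comm a 1))

module _ {a b : ℕ → ℕ} {μ ν : ℕ} (move : ∀ κ → b κ + δ μ κ ≡ a κ + δ ν κ)
         (μ≢ν : μ ≢ ν) (aν≡0 : a ν ≡ 0) where

  -- The first edge of colour `ν` costs nothing, as `1 C 2` is zero, and giving up an edge of colour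
  -- `μ` can only help.
  move-to-free-≤ : ∀ κ → b κ C 2 ≤ a κ C 2
  move-to-free-≤ κ with μ ≟ κ | ν ≟ κ
  ... | yes refl | yes ν≡μ  = contradiction (sym ν≡μ) μ≢ν
  ... | yes μ≡κ  | no  ν≢κ  =
    ≤-trans (C2-step (b κ)) (≤-reflexive (cong (_C 2) (unit-lost (move κ) μ≡κ ν≢κ)))
  ... | no  μ≢κ  | yes refl =
    ≤-trans (≤-reflexive (cong (_C 2) (trans (unit-gained (move κ) μ≢κ refl) (cong suc aν≡0)))) z≤n
  ... | no  μ≢κ  | no  ν≢κ  = ≤-reflexive (cong (_C 2) (unit-same (move κ) μ≢κ ν≢κ))

  move-to-free-< : 2 ≤ a μ → b μ C 2 < a μ C 2
  move-to-free-< 2≤aμ =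
    subst (λ k → b μ C 2 < k C 2) lost (C2-step-< (s≤s⁻¹ (subst (2 ≤_) (sym lost) 2≤aμ)))
    where
    lost : suc (b μ) ≡ a μ
    lost = unit-lost (move μ) refl (μ≢ν ∘ sym)

-- Swapping colours along a trail

record Trail (n : ℕ) (M₁ : Matrix) (x y start : ℕ) (M : Matrix) (mark : ℕ → ℕ) (cur : ℕ) : Set where
  field
    valid       : Valid n M
    cur-bounded : cur < n ∸ 1
    -- Marking both ends keeps the edge `xy` off the trail, so that a step always recolours two
    -- edges at a third vertex.
    marked-x    : mark x ≢ 0
    marked-y    : mark y ≢ 0
    untouched   : ∀ i j → i ≢ x → i ≢ y → j ≢ x → j ≢ y → M i j ≡ M₁ i j
    degree-away : ∀ {u} → u ≢ x → u ≢ y → ∀ κ → degree n M u κ ≡ degree n M₁ u κ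
    degree-x    : ∀ κ → degree n M x κ + δ start κ ≡ degree n M₁ x κ + δ cur κ
    degree-y    : ∀ κ → degree n M y κ + δ cur κ ≡ degree n M₁ y κ + δ start κ
    -- At κ = cur it bounds from below the number of unmarked edges by which
    -- the trail can leave x.
    balance     : ∀ κ → count n mark (M x) κ + (degree n M₁ y κ + δ start κ)
                      ≡ count n mark (M y) κ + (degree n M₁ x κ + δ cur κ)

open Trail

module _ {n : ℕ} {M₁ : Matrix} {x y : ℕ} (x<n : x < n) (y<n : y < n) (x≢y : x ≢ y) where

  -- Before the first step every edge at `x` or `y` except `xy` is unmarked. That edge contributes
  -- equally to both degrees and cancels from `balance`.
  trail-start : ∀ {start mark} → Valid n M₁ → start < n ∸ 1 → mark x ≡ 1 → mark y ≡ 1 →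
                (∀ v → v < n → v ≢ x → v ≢ y → mark v ≡ 0) →
                Trail n M₁ x y start M₁ mark start
  trail-start {start} {mark} V start< mx my free = record
    { valid       = V
    ; cur-bounded = start<
    ; marked-x    = λ eq → 1+n≢0 (trans (sym mx) eq)
    ; marked-y    = λ eq → 1+n≢0 (trans (sym my) eq)
    ; untouched   = λ _ _ _ _ _ _ → refl
    ; degree-away = λ _ _ _ → refl
    ; degree-x    = λ _ → refl
    ; degree-y    = λ _ → refl
    ; balance     = bal
    }
    where
    count-marked : ∀ {u v} → v < n → u ≢ v → mark u ≡ 1 → mark v ≡ 1 →
                   (∀ w → w < n → w ≢ u → w ≢ v → mark w ≡ 0) →
                   ∀ κ → count n mark (M₁ u) κ + δ (M₁ u v) κ ≡ degree n M₁ u κ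
    count-marked {u} {v} v<n u≢v mu mv fr κ =
      count-block n v v<n (δ-≢ u≢v) (λ eq → 1+n≢0 (trans (sym mv) eq)) same (λ _ _ _ _ → refl)
      where
      same : ∀ w → w < n → w ≢ v → mark w ≡ δ u w
      same w w<n w≢v with w ≟ u
      ... | yes refl = trans mu (sym (δ-≡ {u} refl))
      ... | no  w≢u  = trans (fr w w<n w≢u w≢v) (sym (δ-≢ (w≢u ∘ sym)))

    shuffle : ∀ a b m s → a + ((b + m) + s) ≡ b + ((a + m) + s)
    shuffle = solve-∀

    bal : ∀ κ → count n mark (M₁ x) κ + (degree n M₁ y κ + δ start κ)
              ≡ count n mark (M₁ y) κ + (degree n M₁ x κ + δ start κ)
    bal κ =
      subst₂ (λ dx dy → Ux + (dy + δ start κ) ≡ Uy + (dx + δ start κ))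
        (count-marked y<n x≢y mx my free κ)
        (trans (cong (λ μ → Uy + δ μ κ) (symmetric V x<n y<n x≢y))
          (count-marked x<n (x≢y ∘ sym) my mx (λ w w<n w≢y w≢x → free w w<n w≢x w≢y) κ))
        (shuffle Ux Uy (δ (M₁ x y) κ) (δ start κ))
      where
      Ux Uy : ℕ
      Ux = count n mark (M₁ x) κ
      Uy = count n mark (M₁ y) κ

  -- A step uses up an unmarked edge of colour `cur` at `x` and one of colour `M y w` at `y`. The
  -- latter becomes the current colour, and exactly this change of `δ cur κ` keeps `balance` true.
  trail-step : ∀ {start M mark cur} → Trail n M₁ x y start M mark cur →
               ∀ {w M′ M″ mark′} → w < n → mark w ≡ 0 → M x w ≡ cur →
               Recoloured x w (M y w) M M′ → Recoloured y w cur M′ M″ →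
               mark′ w ≢ 0 → (∀ v → v ≢ w → mark′ v ≡ mark v) →
               Trail n M₁ x y start M″ mark′ (M y w)
  trail-step {start} {M} {mark} {cur} T {w} {M′} {M″} {mark′} w<n mw Mxw r r′ mw′ off = record
    { valid       = V″
    ; cur-bounded = t<
    ; marked-x    = marked-x T ∘ trans (sym (off x x≢w))
    ; marked-y    = marked-y T ∘ trans (sym (off y y≢w))
    ; untouched   = λ i j i≢x i≢y j≢x j≢y →
        trans (elsewhere r′ i j (i≢y ∘ proj₁) (j≢y ∘ proj₂))
          (trans (elsewhere r i j (i≢x ∘ proj₁) (j≢x ∘ proj₂)) (untouched T i j i≢x i≢y j≢x j≢y))
    ; degree-away = away
    ; degree-x    = deg-x
    ; degree-y    = λ κ → trans (step-y κ) (degree-y T κ)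
    ; balance     = bal
    }
    where
    t : ℕ
    t = M y w

    x≢w : x ≢ w
    x≢w refl = marked-x T mw

    y≢w : y ≢ w
    y≢w refl = marked-y T mw

    t< : t < n ∸ 1
    t< = bounded (valid T) y<n w<n y≢w

    V′ : Valid n M′
    V′ = recoloured-valid (valid T) t< r

    V″ : Valid n M″
    V″ = recoloured-valid V′ (cur-bounded T) r′

    M′yw : M′ y w ≡ t
    M′yw = elsewhere r y w (x≢y ∘ sym ∘ proj₁) (y≢w ∘ proj₁)

    step-x : ∀ κ → degree n M″ x κ + δ cur κ ≡ degree n M x κ + δ t κ
    step-x κ = subst₂ (λ d μ → d + δ μ κ ≡ degree n M x κ + δ t κ)
      (sym (recoloured-degree-away n r′ x≢y x≢w κ)) Mxw (recoloured-degree-end n w<n x≢w r κ)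

    step-y : ∀ κ → degree n M″ y κ + δ t κ ≡ degree n M y κ + δ cur κ
    step-y κ = subst₂ (λ d μ → degree n M″ y κ + δ μ κ ≡ d + δ cur κ)
      (recoloured-degree-away n r (x≢y ∘ sym) y≢w κ) M′yw (recoloured-degree-end n w<n y≢w r′ κ)

    deg-x : ∀ κ → degree n M″ x κ + δ start κ ≡ degree n M₁ x κ + δ t κ
    deg-x κ = +-cancelʳ-≡ (δ cur κ) _ _
      (trans (swap₁ (degree n M″ x κ) (δ start κ) (δ cur κ))
        (trans (cong (_+ δ start κ) (step-x κ))
          (trans (swap₁ (degree n M x κ) (δ t κ) (δ start κ))
            (trans (cong (_+ δ t κ) (degree-x T κ))
              (swap₁ (degree n M₁ x κ) (δ cur κ) (δ t κ))))))
      where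
      swap₁ : ∀ a b c → (a + b) + c ≡ (a + c) + b
      swap₁ = solve-∀

    away : ∀ {u} → u ≢ x → u ≢ y → ∀ κ → degree n M″ u κ ≡ degree n M₁ u κ
    away {u} u≢x u≢y κ with u ≟ w
    ... | no u≢w =
      trans (recoloured-degree-away n r′ u≢y u≢w κ)
        (trans (recoloured-degree-away n r u≢x u≢w κ) (degree-away T u≢x u≢y κ))
    -- `w` is an end of both recoloured edges: it trades `cur` for `t` and then `t` for `cur`.
    ... | yes refl = trans (+-cancelʳ-≡ (δ t κ) _ _ (trans w-second w-first)) (degree-away T u≢x u≢y κ)
      where
      w-first : degree n M′ w κ + δ cur κ ≡ degree n M w κ + δ t κ
      w-first = subst (λ μ → degree n M′ w κ + δ μ κ ≡ degree n M w κ + δ t κ)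
        (trans (symmetric (valid T) w<n x<n u≢x) Mxw)
        (recoloured-degree-end n x<n u≢x (flip-recoloured r) κ)

      w-second : degree n M″ w κ + δ t κ ≡ degree n M′ w κ + δ cur κ
      w-second = subst (λ μ → degree n M″ w κ + δ μ κ ≡ degree n M′ w κ + δ cur κ)
        (trans (symmetric V′ w<n y<n u≢y) M′yw)
        (recoloured-degree-end n y<n u≢y (flip-recoloured r′) κ)

    bal : ∀ κ → count n mark′ (M″ x) κ + (degree n M₁ y κ + δ start κ)
              ≡ count n mark′ (M″ y) κ + (degree n M₁ x κ + δ t κ)
    bal κ = +-cancelʳ-≡ (δ cur κ) _ _
      (trans (pull (count n mark′ (M″ x) κ) (degree n M₁ y κ + δ start κ) (δ cur κ))
        (trans (cong (_+ (degree n M₁ y κ + δ start κ)) used-x)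
          (trans (balance T κ)
            (trans (cong (_+ (degree n M₁ x κ + δ cur κ)) (sym used-y))
              (push (count n mark′ (M″ y) κ) (δ t κ) (degree n M₁ x κ) (δ cur κ))))))
      where
      pull : ∀ a b c → (a + b) + c ≡ (a + c) + b
      pull = solve-∀

      push : ∀ a t d c → (a + t) + (d + c) ≡ (a + (d + t)) + c
      push = solve-∀

      used-x : count n mark′ (M″ x) κ + δ cur κ ≡ count n mark (M x) κ
      used-x = subst (λ μ → count n mark′ (M″ x) κ + δ μ κ ≡ count n mark (M x) κ) Mxw
        (count-block n w w<n mw mw′ (λ v _ → off v)
          (λ v _ v≢w _ → trans (elsewhere r′ x v (x≢y ∘ proj₁) (x≢w ∘ proj₁))
                               (elsewhere r x v (v≢w ∘ proj₂) (x≢w ∘ proj₁))))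

      used-y : count n mark′ (M″ y) κ + δ t κ ≡ count n mark (M y) κ
      used-y = count-block n w w<n mw mw′ (λ v _ → off v)
        (λ v _ v≢w _ → trans (elsewhere r′ y v (v≢w ∘ proj₂) (y≢w ∘ proj₁))
                             (elsewhere r y v (x≢y ∘ sym ∘ proj₁) (y≢w ∘ proj₁)))

  module _ {start : ℕ} {M : Matrix} {mark : ℕ → ℕ} {cur : ℕ} (T : Trail n M₁ x y start M mark cur)
           (2≤x : 2 ≤ degree n M₁ x start) (y≡0 : degree n M₁ y start ≡ 0) where

    -- With `κ = cur` and an empty count at `x`, `balance` would make the degree at `x` plus one at
    -- most the degree at `y` plus `δ start cur`. If `cur` is not the starting colour, this
    -- contradicts the hypothesis; if it is, it contradicts that this colour is repeated at `x` and
    -- absent at `y`.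
    trail-continues : degree n M₁ y cur ≤ degree n M₁ x cur →
                      ∃[ w ] (w < n × mark w ≡ 0 × M x w ≡ cur)
    trail-continues dy≤dx = count-pos n (n≢0⇒n>0 used-up)
      where
      surplus : degree n M₁ y cur + δ start cur < degree n M₁ x cur + δ cur cur
      surplus with start ≟ cur
      ... | yes refl =
        subst₂ (λ d e → d + e < degree n M₁ x cur + δ cur cur) (sym y≡0) (sym (δ-≡ {cur} refl))
          (≤-trans 2≤x (m≤m+n _ _))
      ... | no  s≢c =
        subst₂ (λ d e → degree n M₁ y cur + d < degree n M₁ x cur + e)
          (sym (δ-≢ s≢c)) (sym (δ-≡ {cur} refl))
          (≤-trans (≤-reflexive (trans (cong suc (+-identityʳ _)) (+-comm 1 _))) (+-monoˡ-≤ 1 dy≤dx))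

      used-up : count n mark (M x) cur ≢ 0
      used-up U≡0 = <⇒≱ surplus
        (≤-trans (m≤n+m _ (count n mark (M y) cur))
          (≤-reflexive (trans (sym (balance T cur)) (cong (_+ (degree n M₁ y cur + δ start cur)) U≡0))))

    module _ (dx<dy : degree n M₁ x cur < degree n M₁ y cur) where

      start≢cur : start ≢ cur
      start≢cur refl = contradiction (subst (_ <_) y≡0 dx<dy) λ ()

      end-start-x : suc (degree n M x start) ≡ degree n M₁ x start
      end-start-x = unit-lost (degree-x T start) refl (start≢cur ∘ sym)

      end-start-y : degree n M y start ≡ 1
      end-start-y = trans (unit-gained (degree-y T start) (start≢cur ∘ sym) refl) (cong suc y≡0)

      column-< : degree n M x start C 2 + degree n M y start C 2
               < degree n M₁ x start C 2 + degree n M₁ y start C 2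
      column-< = subst₂ _<_
        (trans (+-comm (1 C 2) _) (cong (λ k → degree n M x start C 2 + k C 2) (sym end-start-y)))
        (trans (+-comm (0 C 2) _)
          (cong₂ (λ k l → k C 2 + l C 2) end-start-x (sym y≡0)))
        -- `y` goes from zero to one edge of colour `start`. As the colour was repeated at `x`, at
        -- least one edge of it remains there, which makes the move strict.
        (C2-move-< {0} {degree n M x start} (s≤s⁻¹ (subst (2 ≤_) (sym end-start-x) 2≤x)))

      column-≤ : ∀ κ → degree n M x κ C 2 + degree n M y κ C 2
                     ≤ degree n M₁ x κ C 2 + degree n M₁ y κ C 2
      column-≤ κ with start ≟ κ | cur ≟ κ
      ... | yes refl | _ = <⇒≤ column-<
      ... | no s≢κ | no c≢κ = ≤-reflexive (cong₂ (λ k l → k C 2 + l C 2)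
        (unit-same (degree-x T κ) s≢κ c≢κ) (unit-same (degree-y T κ) c≢κ s≢κ))
      -- One edge of colour `cur` moves from `y`, where this colour was strictly more frequent, to
      -- `x`.
      ... | no s≢κ | yes refl = subst₂ _≤_
        (cong (λ k → k C 2 + degree n M y cur C 2) (sym gained))
        (cong (λ k → degree n M₁ x cur C 2 + k C 2) lost)
        (C2-move-≤ (s≤s⁻¹ (subst (suc (degree n M₁ x cur) ≤_) (sym lost) dx<dy)))
        where
        gained : degree n M x cur ≡ suc (degree n M₁ x cur)
        gained = unit-gained (degree-x T cur) s≢κ refl

        lost : suc (degree n M y cur) ≡ degree n M₁ y cur
        lost = unit-lost (degree-y T cur) refl s≢κ

-- In the second case the edge xz is recoloured with κ first: this costs at
-- most one at x and gains at least one at z.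
record Selected (n : ℕ) (M : Matrix) (x y κ z : ℕ) : Set where
  field
    x<n    : x < n
    y<n    : y < n
    z<n    : z < n
    x≢z    : x ≢ z
    y-free : degree n M y κ ≡ 0
    kind   : (M x z ≡ κ × 2 ≤ degree n M x κ) ⊎
             (z ≢ y × degree n M z κ ≡ 0 × degree n M x κ ≡ 1 × 2 ≤ degree n M z (M x z))

open Selected

-- A selected pair leads to lower energy

module _ {n : ℕ} {M : Matrix} {x y κ z : ℕ} (V : Valid n M) (S : Selected n M x y κ z) where

  κ-used : 0 < degree n M x κ
  κ-used = [ (λ (_ , 2≤) → ≤-trans (s≤s z≤n) 2≤)
           , (λ (_ , _ , ≡1 , _) → ≤-reflexive (sym ≡1)) ]′ (kind S)

  κ-bounded : κ < n ∸ 1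
  κ-bounded = let v , v<n , x≢v , Mxv = neighbour n {M} κ-used in
    subst (_< n ∸ 1) Mxv (bounded V (x<n S) v<n x≢v)

  selected-distinct : x ≢ y
  selected-distinct refl = contradiction (subst (0 <_) (y-free S) κ-used) λ ()

  module _ {M₁ : Matrix} (r : Recoloured x z κ M M₁) where

    -- In the first kind `xz` already has colour `κ`, so painting it changes nothing and the program
    -- can paint in both kinds. In the second kind `xz` becomes the second edge of colour `κ` at
    -- `x`.
    κ-twice : 2 ≤ degree n M₁ x κ
    κ-twice with kind S | recoloured-degree-end n (z<n S) (x≢z S) r κ
    ... | inj₁ (refl , 2≤) | eq = ≤-trans 2≤ (≤-reflexive (sym (+-cancelʳ-≡ _ _ _ eq)))
    ... | inj₂ (_ , zκ , xκ , 2≤) | eq =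
      ≤-reflexive (sym (trans (unit-gained eq μ≢κ refl) (cong suc xκ)))
      where
      μ≢κ : M x z ≢ κ
      μ≢κ μ≡κ = contradiction (subst (2 ≤_) (trans (cong (degree n M z) μ≡κ) zκ) 2≤) λ ()

    y-still-free : degree n M₁ y κ ≡ 0
    y-still-free with y ≟ z
    ... | no y≢z = trans (recoloured-degree-away n r (selected-distinct ∘ sym) y≢z κ) (y-free S)
    ... | yes refl with kind S
    ...   | inj₂ (z≢y , _) = contradiction refl z≢y
    ...   | inj₁ (Mxz , _) =
      trans (+-cancelʳ-≡ _ _ _
              (trans (cong (λ μ → degree n M₁ y κ + δ μ κ)
                       (trans (sym Mxz) (symmetric V (x<n S) (y<n S) (x≢z S))))
                     (recoloured-degree-end n (x<n S) (x≢z S ∘ sym) (flip-recoloured r) κ)))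
            (y-free S)

    -- In the first kind the drop occurs in column `κ` of the pair `x`, `y`, and other vertices keep
    -- their degrees. In the second kind it occurs at `z`; the pair only has to avoid a loss, which
    -- holds because the trail takes away the repetition of `κ` at `x` that the recolouring created.
    selected-improves : ∀ {M′ mark cur} → Trail n M₁ x y κ M′ mark cur →
                        degree n M₁ x cur < degree n M₁ y cur → energy n M′ < energy n M
    selected-improves {M′} {mark} {cur} T dx<dy with kind S
    ... | inj₁ (Mxz , _) =
      sum-pair-< n (x<n S) (y<n S) selected-distinct away
        (subst₂ _<_ (sum-+ (n ∸ 1) _ _) (sum-+ (n ∸ 1) _ _)
          (sum-mono-< (n ∸ 1) κ κ-bounded
            (λ λ′ _ → ≤-trans (column-≤ xn yn sd T κ-twice y-still-free dx<dy λ′) (≤-reflexive (same₂ λ′)))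
            (≤-trans (column-< xn yn sd T κ-twice y-still-free dx<dy) (≤-reflexive (same₂ κ)))))
      where
      xn = x<n S
      yn = y<n S
      sd = selected-distinct

      same : ∀ u λ′ → degree n M₁ u λ′ ≡ degree n M u λ′
      same u λ′ = degree-cong n M₁≡M u λ′
        where
        M₁≡M : ∀ i j → M₁ i j ≡ M i j
        M₁≡M i j with (i ≟ x) ×-dec (j ≟ z) | (i ≟ z) ×-dec (j ≟ x)
        ... | yes (refl , refl) | _ = trans (forth r) (sym Mxz)
        ... | no _ | yes (refl , refl) =
          trans (back r) (trans (sym Mxz) (symmetric V (x<n S) (z<n S) (x≢z S)))
        ... | no ≢xz | no ≢zx = elsewhere r i j ≢xz ≢zx

      same₂ : ∀ λ′ → degree n M₁ x λ′ C 2 + degree n M₁ y λ′ C 2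
                   ≡ degree n M x λ′ C 2 + degree n M y λ′ C 2
      same₂ λ′ = cong₂ (λ k l → k C 2 + l C 2) (same x λ′) (same y λ′)

      away : ∀ u → u < n → u ≢ x → u ≢ y → _ ≤ _
      away u _ u≢x u≢y = ≤-reflexive (sum-cong (n ∸ 1) λ λ′ _ →
        cong (_C 2) (trans (degree-away T u≢x u≢y λ′) (same u λ′)))
    ... | inj₂ (z≢y , zκ , xκ , 2≤) =
      sum-away-< n (x<n S) (y<n S) selected-distinct away
        (subst₂ _≤_ (sum-+ (n ∸ 1) _ _) (sum-+ (n ∸ 1) _ _)
          (sum-mono (n ∸ 1) λ λ′ _ → pair λ′))
        z (z<n S) (x≢z S ∘ sym) z≢y
        (sum-mono-< (n ∸ 1) (M x z) (bounded V (x<n S) (z<n S) (x≢z S))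
          (λ λ′ _ → move-to-free-≤ move-z μ≢κ zκ λ′) (move-to-free-< move-z μ≢κ zκ 2≤))
      where
      μ≢κ : M x z ≢ κ
      μ≢κ μ≡κ = contradiction (subst (2 ≤_) (trans (cong (degree n M z) μ≡κ) zκ) 2≤) λ ()

      move-z : ∀ λ′ → degree n M′ z λ′ + δ (M x z) λ′ ≡ degree n M z λ′ + δ κ λ′
      move-z λ′ = subst₂ (λ d μ → d + δ μ λ′ ≡ degree n M z λ′ + δ κ λ′)
        (sym (degree-away T (x≢z S ∘ sym) z≢y λ′)) (symmetric V (z<n S) (x<n S) (x≢z S ∘ sym))
        (recoloured-degree-end n (x<n S) (x≢z S ∘ sym) (flip-recoloured r) λ′)

      away : ∀ u → u < n → u ≢ x → u ≢ y → _ ≤ _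
      away u _ u≢x u≢y with u ≟ z
      ... | yes refl = sum-mono (n ∸ 1) λ λ′ _ → move-to-free-≤ move-z μ≢κ zκ λ′
      ... | no u≢z = ≤-reflexive (sum-cong (n ∸ 1) λ λ′ _ →
        cong (_C 2) (trans (degree-away T u≢x u≢y λ′) (recoloured-degree-away n r u≢x u≢z λ′)))

      pair : ∀ λ′ → degree n M′ x λ′ C 2 + degree n M′ y λ′ C 2
                  ≤ degree n M x λ′ C 2 + degree n M y λ′ C 2
      pair λ′ with κ ≟ λ′
      -- The trail ends with exactly one edge of colour `κ` at `x` and one at `y`, so both binomials
      -- vanish.
      ... | yes refl = ≤-trans (≤-reflexive (cong₂ (λ k l → k C 2 + l C 2)
              (suc-injective (trans (end-start-x (x<n S) (y<n S) selected-distinct T κ-twice y-still-free dx<dy)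
                (trans (unit-gained (recoloured-degree-end n (z<n S) (x≢z S) r κ) μ≢κ refl) (cong suc xκ))))
              (end-start-y (x<n S) (y<n S) selected-distinct T κ-twice y-still-free dx<dy))) z≤n
      ... | no κ≢λ = ≤-trans
        (column-≤ (x<n S) (y<n S) selected-distinct T κ-twice y-still-free dx<dy λ′)
        (+-mono-≤ x≤ (≤-reflexive (cong (_C 2)
          (recoloured-degree-away n r (selected-distinct ∘ sym) (z≢y ∘ sym) λ′))))
        where
        x≤ : degree n M₁ x λ′ C 2 ≤ degree n M x λ′ C 2
        x≤ with M x z ≟ λ′
        ... | yes μ≡ = ≤-trans (C2-step (degree n M₁ x λ′)) (≤-reflexive (cong (_C 2)
          (unit-lost (recoloured-degree-end n (z<n S) (x≢z S) r λ′) μ≡ κ≢λ)))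
        ... | no μ≢ = ≤-reflexive (cong (_C 2)
          (unit-same (recoloured-degree-end n (z<n S) (x≢z S) r λ′) μ≢ κ≢λ))

-- Finding a starting point

LocallyOptimalMatrix : ℕ → Matrix → Set
LocallyOptimalMatrix n M =
  ∀ x z ν → x < n → z < n → x ≢ z → ν < n ∸ 1 → ν ≢ M x z →
  energy n M ≤ energy n (recolour x z ν M)

-- The handshake lemma. The last row and the last column agree by symmetry and their common corner
-- is zero, so together they add twice a row sum.
sum-symmetric-even : ∀ n (f : ℕ → ℕ → ℕ) → (∀ i j → i < n → j < n → f i j ≡ f j i) →
                     (∀ i → f i i ≡ 0) → 2 ∣ sumBelow n λ i → sumBelow n (f i)
sum-symmetric-even zero    f f-sym f-diag = 2 ∣0
sum-symmetric-even (suc n) f f-sym f-diag = subst (2 ∣_) (sym eq)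
  (∣m∣n⇒∣m+n (sum-symmetric-even n f
               (λ i j i<n j<n → f-sym i j (m<n⇒m<1+n i<n) (m<n⇒m<1+n j<n)) f-diag)
             (m∣m*n (sumBelow n (f n))))
  where
  double : ∀ s t → (s + t) + (t + 0) ≡ s + 2 * t
  double = solve-∀

  eq : sumBelow n (λ i → sumBelow n (f i) + f i n) + (sumBelow n (f n) + f n n)
       ≡ sumBelow n (λ i → sumBelow n (f i)) + 2 * sumBelow n (f n)
  eq = trans (cong₂ _+_
         (trans (sum-+ n (λ i → sumBelow n (f i)) (λ i → f i n))
           (cong (sumBelow n (λ i → sumBelow n (f i)) +_)
             (sum-cong n λ i i<n → f-sym i n (m<n⇒m<1+n i<n) (n<1+n n))))
         (cong (sumBelow n (f n) +_) (f-diag n)))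
       (double (sumBelow n λ i → sumBelow n (f i)) (sumBelow n (f n)))

module _ {n : ℕ} {M : Matrix} (V : Valid n M) where

  degrees-even : ∀ κ → 2 ∣ sumBelow n λ u → degree n M u κ
  degrees-even κ = sum-symmetric-even n (λ u v → slot (δ u v) (M u v) κ) sym′
    (λ u → slot-blocked (M u u) κ (λ eq → δ≡0⇒≢ eq refl))
    where
    sym′ : ∀ i j → i < n → j < n → slot (δ i j) (M i j) κ ≡ slot (δ j i) (M j i) κ
    sym′ i j i<n j<n with i ≟ j
    ... | yes refl = refl
    ... | no  i≢j  = cong₂ (λ k μ → slot k μ κ) (δ-comm i j) (symmetric V i<n j<n i≢j)

  degrees-total : ∀ {u} → u < n → sumBelow (n ∸ 1) (degree n M u) ≤ n ∸ 1
  degrees-total {u} u<n = begin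
    sumBelow (n ∸ 1) (degree n M u)
      ≡⟨ sum-swap (n ∸ 1) n (λ κ v → slot (δ u v) (M u v) κ) ⟩
    sumBelow n (λ v → sumBelow (n ∸ 1) λ κ → slot (δ u v) (M u v) κ)
      ≤⟨ sum-mono n one-colour ⟩
    sumBelow n (λ v → 1 ∸ δ u v)
      -- The one that is added and removed again stands for the term missing at `v = u`.
      ≡⟨ m+n∸n≡m _ 1 ⟨
    sumBelow n (λ v → 1 ∸ δ u v) + 1 ∸ 1
      ≡⟨ cong (_∸ 1) (sum-replace n u u<n (λ v _ v≢u → cong (1 ∸_) (δ-≢ (v≢u ∘ sym)))
                        (cong (λ k → 1 ∸ k + 1) (δ-≡ {u} refl))) ⟩
    sumBelow n (λ _ → 1) + 0 ∸ 1
      ≡⟨ cong (_∸ 1) (trans (+-identityʳ _) (trans (sum-const n 1) (*-identityʳ n))) ⟩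
    n ∸ 1 ∎
    where
    open ≤-Reasoning

    one-colour : ∀ v → v < n → sumBelow (n ∸ 1) (λ κ → slot (δ u v) (M u v) κ) ≤ 1 ∸ δ u v
    one-colour v v<n with u ≟ v
    ... | yes refl = ≤-trans (≤-reflexive (sum-zero (n ∸ 1) λ κ _ →
                       slot-blocked (M u u) κ (λ eq → δ≡0⇒≢ eq refl))) z≤n
    ... | no  u≢v  = ≤-reflexive (trans
        (sum-single (n ∸ 1) (M u v) (bounded V u<n v<n u≢v)
          (λ κ _ κ≢ → trans (slot-free (M u v) κ (δ-≢ u≢v)) (δ-≢ (κ≢ ∘ sym))))
        (trans (slot-free (M u v) (M u v) (δ-≢ u≢v))
          (trans (δ-≡ {M u v} refl) (cong (1 ∸_) (sym (δ-≢ u≢v))))))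

  -- Pigeonhole: if all `n ∸ 1` colours occurred at `x`, one of them twice, the degrees would exceed
  -- the bound of `degrees-total`.
  free-colour : ∀ {x μ} → x < n → μ < n ∸ 1 → 2 ≤ degree n M x μ →
                ∃[ ν ] (ν < n ∸ 1 × degree n M x ν ≡ 0)
  free-colour {x} {μ} x<n μ< 2≤ with anyUpTo? (λ ν → degree n M x ν ≟ 0) (n ∸ 1)
  ... | yes found = found
  ... | no  none  = contradiction (degrees-total x<n) (<⇒≱ (subst (_< sumBelow (n ∸ 1) (degree n M x))
          (trans (sum-const (n ∸ 1) 1) (*-identityʳ (n ∸ 1)))
          (sum-mono-< (n ∸ 1) μ μ< (λ κ κ< → n≢0⇒n>0 λ eq → none (κ , κ< , eq)) 2≤)))

  -- Otherwise the degrees in colour `ν` would sum to one less than the even number `n`, against the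
  -- handshake lemma.
  unmatched : ∀ {x ν} → 2 ∣ n → x < n → degree n M x ν ≡ 0 →
              ∃[ y ] (y < n × y ≢ x × degree n M y ν ≢ 1)
  unmatched {x} {ν} 2∣n x<n x-free
    with anyUpTo? (λ y → ¬? (y ≟ x) ×-dec ¬? (degree n M y ν ≟ 1)) n
  ... | yes found = found
  ... | no  none  = contradiction (∣1⇒≡1 (∣m+n∣m⇒∣n (subst (2 ∣_) (sym total) 2∣n) (degrees-even ν))) λ ()
    where
    one : ∀ y → y < n → y ≢ x → degree n M y ν ≡ 1
    one y y<n y≢x with degree n M y ν ≟ 1
    ... | yes eq = eq
    ... | no  ne = contradiction (y , y<n , y≢x , ne) none

    total : sumBelow n (λ y → degree n M y ν) + 1 ≡ n
    total = trans (sum-replace n x x<n one (cong (_+ 1) x-free))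
              (trans (+-identityʳ _) (trans (sum-const n 1) (*-identityʳ n)))

  module _ (opt : LocallyOptimalMatrix n M) where

    -- If `ν` were missing at both ends, recolouring `xz` with it would remove a repetition at `x`
    -- and create none anywhere.
    neighbour-not-free : ∀ {x z ν} → x < n → z < n → x ≢ z → ν < n ∸ 1 →
                         2 ≤ degree n M x (M x z) → degree n M x ν ≡ 0 → degree n M z ν ≢ 0
    neighbour-not-free {x} {z} {ν} x<n z<n x≢z ν< 2≤ xν zν =
      <⇒≱ (decrease (recolour-recoloured x z ν M)) (opt x z ν x<n z<n x≢z ν< (μ≢ν ∘ sym))
      where
      μ : ℕ
      μ = M x z

      μ≢ν : μ ≢ ν
      μ≢ν μ≡ν = contradiction (subst (2 ≤_) (trans (cong (degree n M x) μ≡ν) xν) 2≤) λ ()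

      decrease : ∀ {M′} → Recoloured x z ν M M′ → energy n M′ < energy n M
      decrease {M′} r =
        sum-mono-< n x x<n rows
          (sum-mono-< (n ∸ 1) μ (bounded V x<n z<n x≢z)
            (λ κ _ → move-to-free-≤ move-x μ≢ν xν κ) (move-to-free-< move-x μ≢ν xν 2≤))
        where
        move-x : ∀ κ → degree n M′ x κ + δ μ κ ≡ degree n M x κ + δ ν κ
        move-x = recoloured-degree-end n z<n x≢z r

        move-z : ∀ κ → degree n M′ z κ + δ μ κ ≡ degree n M z κ + δ ν κ
        move-z κ = subst (λ λ′ → degree n M′ z κ + δ λ′ κ ≡ degree n M z κ + δ ν κ)
          (symmetric V z<n x<n (x≢z ∘ sym))
          (recoloured-degree-end n x<n (x≢z ∘ sym) (flip-recoloured r) κ)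

        rows : ∀ u → u < n → sumBelow (n ∸ 1) (λ κ → degree n M′ u κ C 2)
                           ≤ sumBelow (n ∸ 1) (λ κ → degree n M u κ C 2)
        rows u _ with u ≟ x | u ≟ z
        ... | yes refl | _ = sum-mono (n ∸ 1) λ κ _ → move-to-free-≤ move-x μ≢ν xν κ
        ... | no _ | yes refl = sum-mono (n ∸ 1) λ κ _ → move-to-free-≤ move-z μ≢ν zν κ
        ... | no u≢x | no u≢z = ≤-reflexive (sum-cong (n ∸ 1) λ κ _ →
          cong (_C 2) (recoloured-degree-away n r u≢x u≢z κ))

    private
      ≥2-selected : ∀ {x y κ} → x < n → y < n → degree n M y κ ≡ 0 → 2 ≤ degree n M x κ →
                    ∃[ z ] Selected n M x y κ z
      ≥2-selected x<n y<n y-free 2≤ =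
        let z , z<n , x≢z , Mxz = neighbour n {M} (≤-trans (s≤s z≤n) 2≤)
        in  z , record { x<n = x<n ; y<n = y<n ; z<n = z<n ; x≢z = x≢z ; y-free = y-free
                       ; kind = inj₁ (Mxz , 2≤) }

    selection : 2 ∣ n → ∀ {u μ} → u < n → μ < n ∸ 1 → 2 ≤ degree n M u μ →
                ∃[ x ] ∃[ y ] ∃[ κ ] ∃[ z ] Selected n M x y κ z
    selection 2∣n {u} {μ} u<n μ< 2≤u with free-colour u<n μ< 2≤u
    ... | ν , ν< , u-free with unmatched 2∣n u<n u-free
    ... | y , y<n , y≢u , y≢1 with degree n M y ν in y-deg
    ... | suc zero = contradiction refl y≢1
    ... | suc (suc d) =
      y , u , ν , ≥2-selected y<n u<n u-free (≤-trans (s≤s (s≤s z≤n)) (≤-reflexive (sym y-deg)))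
    ... | zero with neighbour n {M} (≤-trans (s≤s z≤n) 2≤u)
    ... | z , z<n , u≢z , refl with degree n M z ν in z-deg
    ... | zero = contradiction z-deg (neighbour-not-free u<n z<n u≢z ν< 2≤u u-free)
    ... | suc (suc d) =
      z , y , ν , ≥2-selected z<n y<n y-deg (≤-trans (s≤s (s≤s z≤n)) (≤-reflexive (sym z-deg)))
    -- The letters change roles: `z` is the first vertex of the pair, and `u` is the other end of
    -- the edge to be recoloured.
    ... | suc zero = z , y , ν , u , record
      { x<n = z<n ; y<n = y<n ; z<n = u<n ; x≢z = u≢z ∘ sym ; y-free = y-deg
      ; kind = inj₂ (y≢u ∘ sym , u-free , z-deg ,
                     subst (λ λ′ → 2 ≤ degree n M u λ′) (symmetric V u<n z<n u≢z) 2≤u) }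

-- Colourings and matrices

∑Fin-sumBelow : ∀ n (f : ℕ → ℕ) → sum-syntax +-*-semiring n (λ i → f (toℕ i)) ≡ sumBelow n f
∑Fin-sumBelow zero    f = refl
∑Fin-sumBelow (suc n) f =
  trans (sum-init-last +-*-semiring {n} (λ i → f (toℕ i)))
    (cong₂ _+_
      (trans (sum-cong-≗ +-*-semiring {n} (λ i → cong f (toℕ-inject₁ i))) (∑Fin-sumBelow n f))
      (cong f (toℕ-fromℕ n)))

record Encodes {n} (c : Coloring n) (M : Matrix) : Set where
  field
    colour : ∀ e → M (toℕ (lo e)) (toℕ (hi e)) ≡ toℕ (c e)
    mirror : ∀ e → M (toℕ (hi e)) (toℕ (lo e)) ≡ toℕ (c e)

open Encodes

edge-between : ∀ {n i j} → i < j → (j<n : j < n) →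
               ∃[ e ] (toℕ (lo {n} e) ≡ i × toℕ (hi e) ≡ j)
edge-between {n} {i} {j} i<j j<n =
  mkEdge (fromℕ< i<n) (fromℕ< j<n) (subst₂ _<_ (sym lo≡) (sym hi≡) i<j) , lo≡ , hi≡
  where
  i<n : i < n
  i<n = <-trans i<j j<n

  lo≡ : toℕ (fromℕ< i<n) ≡ i
  lo≡ = toℕ-fromℕ< i<n

  hi≡ : toℕ (fromℕ< j<n) ≡ j
  hi≡ = toℕ-fromℕ< j<n

lo<hi : ∀ {n} (e : Edge n) → toℕ (lo e) < toℕ (hi e)
lo<hi (mkEdge u v u<v) = recompute (u Fin.<? v) u<v

edge-≡ : ∀ {n} {e f : Edge n} → lo e ≡ lo f → hi e ≡ hi f → e ≡ f
edge-≡ refl refl = refl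

module _ {n : ℕ} {c : Coloring n} {M : Matrix} (E : Encodes c M) where

  encodes-valid : Valid n M
  encodes-valid = record { symmetric = sym′ ; bounded = bnd }
    where
    sym′ : ∀ {i j} → i < n → j < n → i ≢ j → M i j ≡ M j i
    sym′ {i} {j} i<n j<n i≢j with <-cmp i j
    ... | tri≈ _ i≡j _ = contradiction i≡j i≢j
    ... | tri< i<j _ _ with edge-between i<j j<n
    ...   | e , refl , refl = trans (colour E e) (sym (mirror E e))
    sym′ {i} {j} i<n j<n i≢j | tri> _ _ j<i with edge-between j<i i<n
    ...   | e , refl , refl = trans (mirror E e) (sym (colour E e))

    bnd : ∀ {i j} → i < n → j < n → i ≢ j → M i j < n ∸ 1
    bnd {i} {j} i<n j<n i≢j with <-cmp i j
    ... | tri≈ _ i≡j _ = contradiction i≡j i≢j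
    ... | tri< i<j _ _ with edge-between i<j j<n
    ...   | e , refl , refl = subst (_< n ∸ 1) (sym (colour E e)) (toℕ<n (c e))
    bnd {i} {j} i<n j<n i≢j | tri> _ _ j<i with edge-between j<i i<n
    ...   | e , refl , refl = subst (_< n ∸ 1) (sym (mirror E e)) (toℕ<n (c e))

decode : ∀ {n M} → Valid n M → Coloring n
decode V (mkEdge u v u<v) = fromℕ< (bounded V (toℕ<n u) (toℕ<n v) (<⇒≢ u<v))

decode-encodes : ∀ {n M} (V : Valid n M) → Encodes (decode V) M
decode-encodes {n} {M} V = record { colour = col ; mirror = mir }
  where
  col : ∀ e → M (toℕ (lo e)) (toℕ (hi e)) ≡ toℕ (decode V e)
  col e@(mkEdge u v u<v) = sym (toℕ-fromℕ< (bounded V (toℕ<n u) (toℕ<n v) (<⇒≢ (lo<hi e))))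

  mir : ∀ e → M (toℕ (hi e)) (toℕ (lo e)) ≡ toℕ (decode V e)
  mir e = trans (symmetric V (toℕ<n (hi e)) (toℕ<n (lo e)) (<⇒≢ (lo<hi e) ∘ sym)) (col e)

-- Colour degrees as sums over ordered pairs

module _ {A B : Set} {P : B → Set} (P? : Decidable P) (g : A → Maybe B) where

  occurrences : List A → ℕ
  occurrences xs = length (filter P? (mapMaybe g xs))

  occurrences-++ : ∀ xs ys → occurrences (xs ++ ys) ≡ occurrences xs + occurrences ys
  occurrences-++ xs ys =
    trans (cong (length ∘ filter P?) (mapMaybe-++ g xs ys))
      (trans (cong length (filter-++ P? (mapMaybe g xs) (mapMaybe g ys)))
        (length-++ (filter P? (mapMaybe g xs))))

  occurrences-tabulate : ∀ {n} {C : Set} (h : C → A) (k : Fin n → C) →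
    occurrences (map h (tabulate k)) ≡ sum-syntax +-*-semiring n (λ j → occurrences (h (k j) ∷ []))
  occurrences-tabulate {zero}  h k = refl
  occurrences-tabulate {suc n} h k =
    trans (occurrences-++ (h (k Fin.zero) ∷ []) (map h (tabulate (k ∘ Fin.suc))))
          (cong (occurrences (h (k Fin.zero) ∷ []) +_) (occurrences-tabulate h (k ∘ Fin.suc)))

  occurrences-product : ∀ {m n} {C D : Set} (h : C → D → A) (k : Fin m → C) (l : Fin n → D) →
    occurrences (cartesianProductWith h (tabulate k) (tabulate l))
    ≡ sum-syntax +-*-semiring m λ i → sum-syntax +-*-semiring n λ j → occurrences (h (k i) (l j) ∷ [])
  occurrences-product {zero}  h k l = refl
  occurrences-product {suc m} h k l =
    trans (occurrences-++ (map (h (k Fin.zero)) (tabulate l)) _)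
      (cong₂ _+_ (occurrences-tabulate (h (k Fin.zero)) l)
                 (occurrences-product h (k ∘ Fin.suc) l))

-- Unification with the definition of `edges` supplies the function as a witness.
edges-mapMaybe : ∀ n → ∃[ g ] edges n ≡ mapMaybe g (cartesianProduct (allFin n) (allFin n))
edges-mapMaybe n = _ , refl

-- The local function of `edges`, which has no name outside it.
toEdge : ∀ n → Fin n × Fin n → Maybe (Edge n)
toEdge n = proj₁ (edges-mapMaybe n)

toEdge-spec : ∀ {n} (u v : Fin n) → (∃[ e ] (toEdge n (u , v) ≡ just e × lo e ≡ u × hi e ≡ v))
                                  ⊎ (¬ u Fin.< v × toEdge n (u , v) ≡ nothing)
toEdge-spec u v with u Fin.<? v
... | yes u<v = inj₁ (mkEdge u v u<v , refl , refl , refl)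
... | no  u≮v = inj₂ (u≮v , refl)

lt : ℕ → ℕ → ℕ
lt i j = 1 ∸ (suc i ∸ j)

lt-yes : ∀ {i j} → i < j → lt i j ≡ 1
lt-yes i<j = cong (1 ∸_) (m≤n⇒m∸n≡0 i<j)

lt-no : ∀ {i j} → ¬ i < j → lt i j ≡ 0
lt-no i≮j = m≤n⇒m∸n≡0 (m<n⇒0<n∸m (s≤s (≮⇒≥ i≮j)))

module _ {n : ℕ} {c : Coloring n} {M : Matrix} (E : Encodes c M) (u : Fin n) (μ : Colour n) where

  private
    hit : ℕ → ℕ
    hit v = slot (δ (toℕ u) v) (M (toℕ u) v) (toℕ μ)

    -- An edge is a pair `i < j`; it is credited to `u` once as its lower end and once as its upper
    -- end, and at most one of the two credits is nonzero.
    from-lo from-hi : ℕ → ℕ → ℕ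
    from-lo i j = δ (toℕ u) i * (lt i j * hit j)
    from-hi i j = δ (toℕ u) j * (lt i j * hit i)

    Incident : Edge n → Set
    Incident e = u ∈ᵉ e × c e ≡ μ

    incident? : Decidable Incident
    incident? e = (u ∈ᵉ? e) ×-dec (c e Fin.≟ μ)

    hit-yes : ∀ {v} → toℕ u ≢ v → M (toℕ u) v ≡ toℕ μ → hit v ≡ 1
    hit-yes {v} u≢v eq = trans (slot-free (M (toℕ u) v) (toℕ μ) (δ-≢ u≢v)) (δ-≡ eq)

    hit-no : ∀ {v} → toℕ u ≢ v → M (toℕ u) v ≢ toℕ μ → hit v ≡ 0
    hit-no {v} u≢v ne = trans (slot-free (M (toℕ u) v) (toℕ μ) (δ-≢ u≢v)) (δ-≢ ne)

    weight : ∀ e → length (filter incident? (e ∷ [])) ≡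
                   from-lo (toℕ (lo e)) (toℕ (hi e)) + from-hi (toℕ (lo e)) (toℕ (hi e))
    weight e with u Fin.≟ lo e | u Fin.≟ hi e | c e Fin.≟ μ
    ... | yes refl | yes u≡hi | _ = contradiction (cong toℕ u≡hi) (<⇒≢ (lo<hi e))
    ... | yes refl | no _ | yes refl = sym (cong₂ _+_
      (cong₂ _*_ (δ-≡ {toℕ u} refl) (cong₂ _*_ (lt-yes (lo<hi e)) (hit-yes (<⇒≢ (lo<hi e)) (colour E e))))
      (cong (_* (lt (toℕ u) (toℕ (hi e)) * hit (toℕ u))) (δ-≢ (<⇒≢ (lo<hi e)))))
    ... | yes refl | no _ | no c≢μ = sym (cong₂ _+_
      (cong₂ _*_ (δ-≡ {toℕ u} refl) (cong₂ _*_ (lt-yes (lo<hi e))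
        (hit-no (<⇒≢ (lo<hi e)) (c≢μ ∘ toℕ-injective ∘ trans (sym (colour E e))))))
      (cong (_* (lt (toℕ u) (toℕ (hi e)) * hit (toℕ u))) (δ-≢ (<⇒≢ (lo<hi e)))))
    ... | no u≢lo | yes refl | yes refl = sym (cong₂ _+_
      (cong (_* (lt (toℕ (lo e)) (toℕ u) * hit (toℕ u))) (δ-≢ (u≢lo ∘ toℕ-injective)))
      (cong₂ _*_ (δ-≡ {toℕ u} refl) (cong₂ _*_ (lt-yes (lo<hi e))
        (hit-yes (u≢lo ∘ toℕ-injective) (mirror E e)))))
    ... | no u≢lo | yes refl | no c≢μ = sym (cong₂ _+_
      (cong (_* (lt (toℕ (lo e)) (toℕ u) * hit (toℕ u))) (δ-≢ (u≢lo ∘ toℕ-injective)))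
      (cong₂ _*_ (δ-≡ {toℕ u} refl) (cong₂ _*_ (lt-yes (lo<hi e))
        (hit-no (u≢lo ∘ toℕ-injective) (c≢μ ∘ toℕ-injective ∘ trans (sym (mirror E e)))))))
    ... | no u≢lo | no u≢hi | _ = sym (cong₂ _+_
      (cong (_* (lt (toℕ (lo e)) (toℕ (hi e)) * hit (toℕ (hi e)))) (δ-≢ (u≢lo ∘ toℕ-injective)))
      (cong (_* (lt (toℕ (lo e)) (toℕ (hi e)) * hit (toℕ (lo e)))) (δ-≢ (u≢hi ∘ toℕ-injective))))

    vanish : ∀ a {b} h → b ≡ 0 → a * (b * h) ≡ 0
    vanish a h refl = *-zeroʳ a

    entry : ∀ i j → occurrences incident? (toEdge n) ((i , j) ∷ []) ≡
                    from-lo (toℕ i) (toℕ j) + from-hi (toℕ i) (toℕ j)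
    entry i j with toEdge n (i , j) | toEdge-spec i j
    ... | _ | inj₁ (e , refl , refl , refl) = weight e
    ... | _ | inj₂ (i≮j , refl) =
      sym (cong₂ _+_ (vanish (δ (toℕ u) (toℕ i)) (hit (toℕ j)) (lt-no i≮j))
                     (vanish (δ (toℕ u) (toℕ j)) (hit (toℕ i)) (lt-no i≮j)))

    pick : ∀ (f : ℕ → ℕ → ℕ) → sumBelow n (λ i → sumBelow n λ j → δ (toℕ u) i * f i j) ≡ sumBelow n (f (toℕ u))
    pick f = trans
      (sum-single n (toℕ u) (toℕ<n u) λ i _ i≢u → sum-zero n λ j _ →
        cong (_* f i j) (δ-≢ (i≢u ∘ sym)))
      (sum-cong n λ j _ → trans (cong (_* f (toℕ u) j) (δ-≡ {toℕ u} refl)) (+-identityʳ _))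

    either-side : ∀ v → lt (toℕ u) v * hit v + lt v (toℕ u) * hit v ≡ hit v
    either-side v with <-cmp (toℕ u) v
    ... | tri< u<v _ v≮u =
      trans (cong₂ (λ k l → k * hit v + l * hit v) (lt-yes u<v) (lt-no v≮u))
        (trans (+-identityʳ _) (+-identityʳ _))
    ... | tri> u≮v _ v<u =
      trans (cong₂ (λ k l → k * hit v + l * hit v) (lt-no u≮v) (lt-yes v<u)) (+-identityʳ _)
    ... | tri≈ u≮v refl v≮u =
      trans (cong₂ (λ k l → k * hit v + l * hit v) (lt-no u≮v) (lt-no v≮u))
        (sym (slot-blocked _ (toℕ μ) (λ eq → δ≡0⇒≢ eq refl)))

  -- The edges with lower end `u` and those with upper end `u` are summed separately; `either-side`
  -- merges the halves, since a vertex other than `u` lies on exactly one side of it.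
  colourDegree-degree : colourDegree c u μ ≡ degree n M (toℕ u) (toℕ μ)
  colourDegree-degree = begin
    colourDegree c u μ
      ≡⟨ occurrences-product incident? (toEdge n) _,_ id id ⟩
    sum-syntax +-*-semiring n (λ i → sum-syntax +-*-semiring n λ j → occurrences incident? (toEdge n) ((i , j) ∷ []))
      ≡⟨ sum-cong-≗ +-*-semiring {n} (λ i → trans (sum-cong-≗ +-*-semiring {n} (entry i))
           (∑Fin-sumBelow n λ j → from-lo (toℕ i) j + from-hi (toℕ i) j)) ⟩
    sum-syntax +-*-semiring n (λ i → sumBelow n λ j → from-lo (toℕ i) j + from-hi (toℕ i) j)
      ≡⟨ ∑Fin-sumBelow n (λ i → sumBelow n λ j → from-lo i j + from-hi i j) ⟩
    sumBelow n (λ i → sumBelow n λ j → from-lo i j + from-hi i j)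
      ≡⟨ sum-cong n (λ i _ → sum-+ n (from-lo i) (from-hi i)) ⟩
    sumBelow n (λ i → sumBelow n (from-lo i) + sumBelow n (from-hi i))
      ≡⟨ sum-+ n (λ i → sumBelow n (from-lo i)) (λ i → sumBelow n (from-hi i)) ⟩
    sumBelow n (λ i → sumBelow n (from-lo i)) + sumBelow n (λ i → sumBelow n (from-hi i))
      ≡⟨ cong₂ _+_ (pick λ i j → lt i j * hit j)
                   (trans (sum-swap n n from-hi) (pick λ j i → lt i j * hit i)) ⟩
    sumBelow n (λ v → lt (toℕ u) v * hit v) + sumBelow n (λ v → lt v (toℕ u) * hit v)
      ≡⟨ sum-+ n (λ v → lt (toℕ u) v * hit v) (λ v → lt v (toℕ u) * hit v) ⟨
    sumBelow n (λ v → lt (toℕ u) v * hit v + lt v (toℕ u) * hit v)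
      ≡⟨ sum-cong n (λ v _ → either-side v) ⟩
    sumBelow n hit ∎
    where open ≡-Reasoning

Ψ-energy : ∀ {n} {c : Coloring n} {M} → Encodes c M → Ψ c ≡ energy n M
Ψ-energy {n} {c} {M} E = trans
  (sum-cong-≗ +-*-semiring {n} λ u → trans
    (sum-cong-≗ +-*-semiring {n ∸ 1} λ μ → cong (_C 2) (colourDegree-degree E u μ))
    (∑Fin-sumBelow (n ∸ 1) λ κ → degree n M (toℕ u) κ C 2))
  (∑Fin-sumBelow n λ u → sumBelow (n ∸ 1) λ κ → degree n M u κ C 2)

-- Local optimality and properness in terms of matrices

module _ {n : ℕ} {c : Coloring n} {M : Matrix} (E : Encodes c M) where

  -- Stated for any matrix related by `Recoloured`, so that the flipped relation covers an edge
  -- given with its ends reversed.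
  recolour-edge-≤ : LocallyOptimal c → ∀ {i j ν M′} → i < j → j < n → ν < n ∸ 1 → ν ≢ M i j →
                    Recoloured i j ν M M′ → energy n M ≤ energy n M′
  recolour-edge-≤ opt {ν = ν} {M′} i<j j<n ν< ν≢ r with edge-between i<j j<n
  ... | e , refl , refl =
    subst₂ _≤_ (Ψ-energy E) (Ψ-energy E′) (opt (decode V′) (e , change , same))
    where
    V′ : Valid n M′
    V′ = recoloured-valid (encodes-valid E) ν< r

    E′ : Encodes (decode V′) M′
    E′ = decode-encodes V′

    change : decode V′ e ≢ c e
    change eq = ν≢ (trans (sym (forth r)) (trans (colour E′ e) (trans (cong toℕ eq) (sym (colour E e)))))

    same : ∀ f → f ≢ e → decode V′ f ≡ c f
    same f f≢e = toℕ-injective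
      (trans (sym (colour E′ f))
        (trans (elsewhere r _ _
                 (λ (p , q) → f≢e (edge-≡ (toℕ-injective p) (toℕ-injective q)))
                 (λ (p , q) → <-asym (lo<hi e) (subst₂ _<_ p q (lo<hi f))))
          (colour E f)))

  locallyOptimal-matrix : LocallyOptimal c → LocallyOptimalMatrix n M
  locallyOptimal-matrix opt x z ν x<n z<n x≢z ν< ν≢ with <-cmp x z
  ... | tri≈ _ x≡z _ = contradiction x≡z x≢z
  ... | tri< x<z _ _ = recolour-edge-≤ opt x<z z<n ν< ν≢ (recolour-recoloured x z ν M)
  ... | tri> _ _ z<x = recolour-edge-≤ opt z<x x<n ν<
    (ν≢ ∘ λ eq → trans eq (symmetric (encodes-valid E) z<n x<n (x≢z ∘ sym)))
    (flip-recoloured (recolour-recoloured x z ν M))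

  private
    Ends : Fin n → Edge n → Fin n → Set
    Ends u e v = (u ≡ lo e × v ≡ hi e) ⊎ (u ≡ hi e × v ≡ lo e)

    other-end : ∀ {u e} → u ∈ᵉ e → ∃[ v ] Ends u e v
    other-end {e = e} (inj₁ u≡lo) = hi e , inj₁ (u≡lo , refl)
    other-end {e = e} (inj₂ u≡hi) = lo e , inj₂ (u≡hi , refl)

    ends-distinct : ∀ {u e v} → Ends u e v → toℕ u ≢ toℕ v
    ends-distinct {e = e} (inj₁ (refl , refl)) = <⇒≢ (lo<hi e)
    ends-distinct {e = e} (inj₂ (refl , refl)) = <⇒≢ (lo<hi e) ∘ sym

    ends-colour : ∀ {u e v} → Ends u e v → M (toℕ u) (toℕ v) ≡ toℕ (c e)
    ends-colour {e = e} (inj₁ (refl , refl)) = colour E e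
    ends-colour {e = e} (inj₂ (refl , refl)) = mirror E e

    ends-≡ : ∀ {u e f v} → Ends u e v → Ends u f v → e ≡ f
    ends-≡ (inj₁ (p , q)) (inj₁ (r , s)) = edge-≡ (trans (sym p) r) (trans (sym q) s)
    ends-≡ (inj₂ (p , q)) (inj₂ (r , s)) = edge-≡ (trans (sym q) s) (trans (sym p) r)
    ends-≡ {e = e} {f} (inj₁ (refl , refl)) (inj₂ (p , q)) =
      contradiction (subst₂ _<_ (cong toℕ p) (cong toℕ q) (lo<hi e)) (<-asym (lo<hi f))
    ends-≡ {e = e} {f} (inj₂ (refl , refl)) (inj₁ (p , q)) =
      contradiction (subst₂ _<_ (cong toℕ q) (cong toℕ p) (lo<hi e)) (<-asym (lo<hi f))

  -- A bounded search decides whether a repetition exists. Without one the colouring is proper: two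
  -- equally coloured edges at `u` with different other ends would each contribute one to the same
  -- degree.
  repeated-colour : ¬ IsOneFactorization c →
                    ∃[ u ] (u < n × ∃[ μ ] (μ < n ∸ 1 × 2 ≤ degree n M u μ))
  repeated-colour ¬proper
    with anyUpTo? (λ u → anyUpTo? (λ μ → 2 ≤? degree n M u μ) (n ∸ 1)) n
  ... | yes found = found
  ... | no  none  = contradiction proper ¬proper
    where
    proper : IsOneFactorization c
    proper u e f u∈e u∈f ce≡cf with other-end {e = e} u∈e | other-end {e = f} u∈f
    ... | v , ends-e | w , ends-f with v Fin.≟ w
    ... | yes refl = ends-≡ {e = e} {f} ends-e ends-f
    ... | no  v≢w  = contradiction
      (toℕ u , toℕ<n u , toℕ (c e) , toℕ<n (c e) , two) none
      where
      once : ∀ {g x} → Ends u g x → c e ≡ c g →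
             slot (δ (toℕ u) (toℕ x)) (M (toℕ u) (toℕ x)) (toℕ (c e)) ≡ 1
      once {g} {x} ends ce≡cg = trans
        (slot-free (M (toℕ u) (toℕ x)) (toℕ (c e)) (δ-≢ (ends-distinct {e = g} ends)))
        (δ-≡ (trans (ends-colour {e = g} ends) (cong toℕ (sym ce≡cg))))

      two : 2 ≤ degree n M (toℕ u) (toℕ (c e))
      two = subst (2 ≤_)
        (sym (sum-split n _ (toℕ<n v) (toℕ<n w) (v≢w ∘ toℕ-injective)))
        (≤-trans (≤-reflexive (sym (cong₂ _+_ (once {e} ends-e refl) (once {f} ends-f ce≡cf))))
                 (m≤n+m _ (sumBelow n (others (toℕ v) (toℕ w) λ x → slot (δ (toℕ u) x) (M (toℕ u) x) (toℕ (c e))))))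

-- Programs with counting loops

infix  5 _≔_ _[_,_]≔_
infixr 4 _⨟_

-- In `for i p` variable i runs from 0 to the value of variable 0, exclusively.
data Stmt : Set where
  _≔_      : ℕ → Expr → Stmt
  _[_,_]≔_ : ℕ → Expr → Expr → Expr → Stmt
  _⨟_      : Stmt → Stmt → Stmt
  unless   : Expr → Stmt → Stmt
  for      : ℕ → Stmt → Stmt

compile : Stmt → Program
compile (x ≔ e)          = setVar x e
compile (a [ i , j ]≔ e) = setArr a i j e
compile (p ⨟ q)          = compile p ⨾ compile q
compile (unless e p)     = ifNonZero e skip (compile p)
compile (for i p)        =
  setVar i (lit 0) ⨾
  whileNonZero (var 0 ⊖ var i) (compile p ⨾ setVar i (var i ⊕ lit 1))

-- The number of rounds is fixed on entry and the counter is written from `m`. This agrees with the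
-- compiled loop when the body preserves both the counter and variable 0, the conditions imposed by
-- `compile-runs`.
iterate : ℕ → (Store → Store) → ℕ → Store → Store
iterate i f zero    s = writeVar i 0 s
iterate i f (suc m) s = writeVar i (suc m) (f (iterate i f m s))

guarded : ℕ → (Store → Store) → Store → Store
guarded zero    f s = f s
guarded (suc _) f s = s

run : Stmt → Store → Store
run (x ≔ e)          s = writeVar x (⟦ e ⟧ s) s
run (a [ i , j ]≔ e) s = writeArr a (⟦ i ⟧ s) (⟦ j ⟧ s) (⟦ e ⟧ s) s
run (p ⨟ q)          s = run q (run p s)
run (unless e p)     s = guarded (⟦ e ⟧ s) (run p) s
run (for i p)        s = iterate i (run p) (vars s 0) s

-- Single writes, and what a statement leaves unchanged

writeVar-same : ∀ x v s → vars (writeVar x v s) x ≡ v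
writeVar-same x v s with x ≟ x
... | yes _   = refl
... | no  x≢x = contradiction refl x≢x

writeVar-other : ∀ {x y} v s → x ≢ y → vars (writeVar y v s) x ≡ vars s x
writeVar-other {x} {y} v s x≢y with x ≟ y
... | yes x≡y = contradiction x≡y x≢y
... | no  _   = refl

writeArr-same : ∀ a i j v s → arrs (writeArr a i j v s) a i j ≡ v
writeArr-same a i j v s with (a ≟ a) ×-dec (i ≟ i) ×-dec (j ≟ j)
... | yes _ = refl
... | no  n = contradiction (refl , refl , refl) n

writeArr-other : ∀ a i j v s {b k l} → ¬ (b ≡ a × k ≡ i × l ≡ j) →
                 arrs (writeArr a i j v s) b k l ≡ arrs s b k l
writeArr-other a i j v s {b} {k} {l} ne with (b ≟ a) ×-dec (k ≟ i) ×-dec (l ≟ j)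
... | yes e = contradiction e ne
... | no  _ = refl

writeArr-keeps : ∀ a i j v s {b k l} → arrs s b k l ≡ v → arrs (writeArr a i j v s) b k l ≡ v
writeArr-keeps a i j v s {b} {k} {l} eq with (b ≟ a) ×-dec (k ≟ i) ×-dec (l ≟ j)
... | yes _ = refl
... | no  _ = eq

-- Defined by recursion, so that for a concrete statement it computes to a product of trivial
-- conditions and is inferred without a written proof.
KeepsVar : ℕ → Stmt → Set
KeepsVar x (y ≔ e)          = False (x ≟ y)
KeepsVar x (a [ i , j ]≔ e) = ⊤
KeepsVar x (p ⨟ q)          = KeepsVar x p × KeepsVar x q
KeepsVar x (unless e p)     = KeepsVar x p
KeepsVar x (for i p)        = False (x ≟ i) × KeepsVar x p

KeepsArr : ℕ → Stmt → Set
KeepsArr a (y ≔ e)          = ⊤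
KeepsArr a (b [ i , j ]≔ e) = False (a ≟ b)
KeepsArr a (p ⨟ q)          = KeepsArr a p × KeepsArr a q
KeepsArr a (unless e p)     = KeepsArr a p
KeepsArr a (for i p)        = KeepsArr a p

keepsVar : ∀ p x → KeepsVar x p → ∀ s → vars (run p s) x ≡ vars s x
keepsVar (y ≔ e)          x k s = writeVar-other _ s (toWitnessFalse k)
keepsVar (a [ i , j ]≔ e) x k s = refl
keepsVar (p ⨟ q)          x (k , l) s = trans (keepsVar q x l (run p s)) (keepsVar p x k s)
keepsVar (unless e p)     x k s with ⟦ e ⟧ s
... | zero  = keepsVar p x k s
... | suc _ = refl
keepsVar (for i p)        x (x≢i , k) s = go (vars s 0)
  where
  go : ∀ m → vars (iterate i (run p) m s) x ≡ vars s x
  go zero    = writeVar-other 0 s (toWitnessFalse x≢i)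
  go (suc m) = trans (writeVar-other (suc m) _ (toWitnessFalse x≢i))
                     (trans (keepsVar p x k _) (go m))

keepsArr : ∀ p a → KeepsArr a p → ∀ s i j → arrs (run p s) a i j ≡ arrs s a i j
keepsArr (y ≔ e)          a k s _ _ = refl
keepsArr (b [ i , j ]≔ e) a k s _ _ = writeArr-other b _ _ _ s (toWitnessFalse k ∘ proj₁)
keepsArr (p ⨟ q)          a (k , l) s i j =
  trans (keepsArr q a l (run p s) i j) (keepsArr p a k s i j)
keepsArr (unless e p)     a k s i j with ⟦ e ⟧ s
... | zero  = keepsArr p a k s i j
... | suc _ = refl
keepsArr (for c p)        a k s i j = go (vars s 0)
  where
  go : ∀ m → arrs (iterate c (run p) m s) a i j ≡ arrs s a i j
  go zero    = refl
  go (suc m) = trans (keepsArr p a k _ i j) (go m)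

KeepsCounters : Stmt → Set
KeepsCounters (x ≔ e)          = ⊤
KeepsCounters (a [ i , j ]≔ e) = ⊤
KeepsCounters (p ⨟ q)          = KeepsCounters p × KeepsCounters q
KeepsCounters (unless e p)     = KeepsCounters p
KeepsCounters (for i p)        = KeepsVar i p × KeepsCounters p

-- Running time

depth : Stmt → ℕ
depth (x ≔ e)          = 0
depth (a [ i , j ]≔ e) = 0
depth (p ⨟ q)          = depth p ⊔ depth q
depth (unless e p)     = depth p
depth (for i p)        = suc (depth p)

factor : Stmt → ℕ
factor (x ≔ e)          = 1 + cost e
factor (a [ i , j ]≔ e) = 1 + cost i + cost j + cost e
factor (p ⨟ q)          = factor p + factor q
factor (unless e p)     = (2 + cost e) + factor p
-- A round costs 8 beyond its body, 4 for the test and 4 for the increment; initialisation and the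
-- last test cost 2 and 4. For positive `n` this overhead is at most `(6 + 8) * n ^ suc (depth p)`.
factor (for i p)        = 14 + factor p

Runs : Stmt → Store → ℕ → Set
Runs p s T = ∃[ t ] (⟨ compile p , s ⟩⇓[ t ] run p s × t ≤ T)

time-bound : Stmt → ℕ → ℕ
time-bound p n = factor p * n ^ depth p

module _ (n : ℕ) .{{_ : NonZero n}} where

  private
    ≤-scale : ∀ {t k} d → t ≤ k → t ≤ k * n ^ d
    ≤-scale {t} {k} d t≤k = ≤-trans t≤k (m≤m*n k (n ^ d) {{m^n≢0 n d}})

    weaken : ∀ k {d d′} → d ≤ d′ → k * n ^ d ≤ k * n ^ d′
    weaken k d≤d′ = *-monoʳ-≤ k (^-monoʳ-≤ n d≤d′)

  -- Since `n` is positive, its powers are at least one and grow with the exponent, so constants and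
  -- shallower substatements are absorbed by the deepest nesting.
  compile-runs : ∀ p → KeepsVar 0 p → KeepsCounters p → ∀ s → vars s 0 ≡ n →
                 Runs p s (time-bound p n)
  compile-runs (x ≔ e)          k₀ k s _ = _ , setVar⇓ , ≤-scale 0 ≤-refl
  compile-runs (a [ i , j ]≔ e) k₀ k s _ = _ , setArr⇓ , ≤-scale 0 ≤-refl
  compile-runs (p ⨟ q) (p₀ , q₀) (kp , kq) s s₀ =
    let t , p⇓ , t≤ = compile-runs p p₀ kp s s₀
        u , q⇓ , u≤ = compile-runs q q₀ kq (run p s) (trans (keepsVar p 0 p₀ s) s₀)
    in  t + u , ⨾⇓ p⇓ q⇓ ,
        ≤-trans (+-mono-≤ (≤-trans t≤ (weaken (factor p) (m≤m⊔n (depth p) (depth q))))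
                          (≤-trans u≤ (weaken (factor q) (m≤n⊔m (depth p) (depth q)))))
                (≤-reflexive (sym (*-distribʳ-+ (n ^ (depth p ⊔ depth q)) (factor p) (factor q))))
  compile-runs (unless e p) p₀ kp s s₀ with ⟦ e ⟧ s in eq
  ... | suc m = _ , then⇓ (λ e≡0 → 1+n≢0 (trans (sym eq) e≡0)) skip⇓ ,
                ≤-scale (depth p) (≤-trans (≤-reflexive (+-comm (1 + cost e) 1)) (m≤m+n (2 + cost e) (factor p)))
  ... | zero  =
    let t , p⇓ , t≤ = compile-runs p p₀ kp s s₀
    in  _ , else⇓ eq p⇓ ,
        ≤-trans (+-mono-≤ (≤-scale (depth p) (n≤1+n (1 + cost e))) t≤)
                (≤-reflexive (sym (*-distribʳ-+ (n ^ depth p) (2 + cost e) (factor p))))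
  compile-runs (for i p) (0≢i , p₀) (kᵢ , kp) s s₀ rewrite s₀ =
    let t , w⇓ , t≤ = loop n 0 refl
    in  _ , ⨾⇓ setVar⇓ w⇓ , ≤-trans (+-monoʳ-≤ 2 t≤) total
    where
    B : ℕ
    B = time-bound p n

    after : ℕ → Store
    after m = iterate i (run p) m s

    body : Program
    body = compile p ⨾ setVar i (var i ⊕ lit 1)

    after-0 : ∀ m → vars (after m) 0 ≡ n
    after-0 zero    = trans (writeVar-other 0 s (toWitnessFalse 0≢i)) s₀
    after-0 (suc m) = trans (writeVar-other (suc m) _ (toWitnessFalse 0≢i))
                            (trans (keepsVar p 0 p₀ _) (after-0 m))

    after-i : ∀ m → vars (after m) i ≡ m
    after-i zero    = writeVar-same i 0 s
    after-i (suc m) = writeVar-same i (suc m) (run p (after m))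

    guard : ∀ m → ⟦ var 0 ⊖ var i ⟧ (after m) ≡ n ∸ m
    guard m = cong₂ _∸_ (after-0 m) (after-i m)

    loop : ∀ r m → m + r ≡ n →
           ∃[ t ] (⟨ whileNonZero (var 0 ⊖ var i) body , after m ⟩⇓[ t ] after n ×
                   t ≤ r * (8 + B) + 4)
    loop zero m eq with trans (sym (+-identityʳ m)) eq
    ... | refl = _ , exit⇓ (trans (guard m) (n∸n≡0 m)) , ≤-refl
    loop (suc r) m eq =
      let t , p⇓ , t≤ = compile-runs p p₀ kp (after m) (after-0 m)
          u , w⇓ , u≤ = loop r (suc m) (trans (sym (+-suc m r)) eq)
          step        = subst (λ v → ⟨ setVar i (var i ⊕ lit 1) , run p (after m) ⟩⇓[ 4 ]
                                       writeVar i v (run p (after m)))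
                              (trans (+-comm _ 1)
                                (cong suc (trans (keepsVar p i kᵢ (after m)) (after-i m))))
                              setVar⇓
      in  _ , loop⇓ (λ g≡0 → m∸n≢0 (trans (sym (guard m)) g≡0)) (⨾⇓ p⇓ step) w⇓ ,
          ≤-trans (+-mono-≤ (+-monoʳ-≤ 4 (+-monoˡ-≤ 4 t≤)) u≤)
                  (≤-reflexive (regroup B (r * (8 + B))))
      where
      m∸n≢0 : n ∸ m ≢ 0
      m∸n≢0 n∸m≡0 = <⇒≱ (≤-trans (m≤m+n (suc m) r) (≤-reflexive (trans (sym (+-suc m r)) eq)))
                        (m∸n≡0⇒m≤n n∸m≡0)

      regroup : ∀ b c → (4 + (b + 4)) + (c + 4) ≡ (8 + b) + c + 4
      regroup = solve-∀

    total : 2 + (n * (8 + B) + 4) ≤ (14 + factor p) * (n * n ^ depth p)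
    total = begin
      2 + (n * (8 + B) + 4)             ≡⟨ split n (n ^ depth p) (factor p) ⟩
      6 + n * 8 + factor p * nd         ≤⟨ +-monoˡ-≤ (factor p * nd) (+-mono-≤ (≤-scale (suc (depth p)) (≤-refl {6})) n*8≤) ⟩
      (6 * nd + 8 * nd) + factor p * nd ≡⟨ collect (factor p) nd ⟩
      (14 + factor p) * nd              ∎
      where
      open ≤-Reasoning
      nd : ℕ
      nd = n * n ^ depth p

      n*8≤ : n * 8 ≤ 8 * nd
      n*8≤ = ≤-trans (≤-reflexive (*-comm n 8)) (*-monoʳ-≤ 8 (m≤m*n n (n ^ depth p) {{m^n≢0 n (depth p)}}))

      split : ∀ n e k → 2 + (n * (8 + k * e) + 4) ≡ 6 + n * 8 + k * (n * e)
      split = solve-∀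

      collect : ∀ k e → (6 * e + 8 * e) + k * e ≡ (14 + k) * e
      collect = solve-∀

-- Reasoning rules for loops

record Frame (p : Stmt) (s s′ : Store) : Set where
  field
    var= : ∀ x {_ : KeepsVar x p} → vars s′ x ≡ vars s x
    arr= : ∀ a {_ : KeepsArr a p} k l → arrs s′ a k l ≡ arrs s a k l

open Frame

run-frame : ∀ p s → Frame p s (run p s)
run-frame p s = record
  { var= = λ x {k} → keepsVar p x k s ; arr= = λ a {k} i j → keepsArr p a k s i j }

-- The frame handed to the step accounts for everything the loop does not write, so an invariant has
-- to mention only what changes.
for-induction :
  ∀ i p s (I : ℕ → Store → Set) → KeepsVar 0 (for i p) → I 0 (writeVar i 0 s) →
  (∀ m s′ → m < vars s 0 → vars s′ i ≡ m →
    Frame (for i p) s s′ → I m s′ → I (suc m) (writeVar i (suc m) (run p s′))) →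
  I (vars s 0) (run (for i p) s)
for-induction i p s I (0≢i , p₀) base step = go (vars s 0) ≤-refl
  where
  after : ℕ → Store
  after m = iterate i (run p) m s

  after-i : ∀ m → vars (after m) i ≡ m
  after-i zero    = writeVar-same i 0 s
  after-i (suc m) = writeVar-same i (suc m) (run p (after m))

  after-var : ∀ m x → KeepsVar x (for i p) → vars (after m) x ≡ vars s x
  after-var zero    x (x≢i , k) = writeVar-other 0 s (toWitnessFalse x≢i)
  after-var (suc m) x (x≢i , k) =
    trans (writeVar-other (suc m) _ (toWitnessFalse x≢i))
          (trans (keepsVar p x k _) (after-var m x (x≢i , k)))

  after-arr : ∀ m a → KeepsArr a p → ∀ k l → arrs (after m) a k l ≡ arrs s a k l
  after-arr zero    a ka k l = refl
  after-arr (suc m) a ka k l = trans (keepsArr p a ka _ k l) (after-arr m a ka k l)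

  go : ∀ m → m ≤ vars s 0 → I m (after m)
  go zero    _   = base
  go (suc m) m<n =
    step m (after m) m<n (after-i m)
      (record { var= = λ x {k} → after-var m x k ; arr= = λ a {k} → after-arr m a k })
      (go m (<⇒≤ m<n))

-- `E` says that the enclosing counters hold their share of a witness, and `k` is the share of this
-- loop. At any time the goal `G` is reached or `k` still lies ahead. The loop does not break off
-- after a success, so `step` must also preserve `G`.
for-find :
  ∀ i p s (G : Store → Set) (E : Set) k → k < vars s 0 → KeepsVar 0 (for i p) →
  (∀ m s′ → G s′ → G (writeVar i m s′)) →
  (∀ s′ → vars s′ i < vars s 0 → Frame (for i p) s s′ → G s′ ⊎ (E × vars s′ i ≡ k) → G (run p s′)) →
  G s ⊎ E → G (run (for i p) s)
for-find i p s G E k k<n keeps stable step start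
  with for-induction i p s (λ m s′ → G s′ ⊎ (E × m ≤ k)) keeps
         ([ inj₁ ∘ stable 0 s , (λ e → inj₂ (e , z≤n)) ]′ start) inv
  where
  inv : ∀ m s′ → m < vars s 0 → vars s′ i ≡ m → Frame (for i p) s s′ → G s′ ⊎ (E × m ≤ k) →
        G (writeVar i (suc m) (run p s′)) ⊎ (E × suc m ≤ k)
  inv m s′ m<n refl fr (inj₁ g) = inj₁ (stable _ _ (step s′ m<n fr (inj₁ g)))
  inv m s′ m<n refl fr (inj₂ (e , m≤k)) with m ≟ k
  ... | yes refl = inj₁ (stable _ _ (step s′ m<n fr (inj₂ (e , refl))))
  ... | no  m≢k  = inj₂ (e , ≤∧≢⇒< m≤k m≢k)
... | inj₁ g         = g
... | inj₂ (_ , n≤k) = contradiction n≤k (<⇒≱ k<n)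

-- The program

-- Arrays 0, 1 and 2 hold colours, degrees and marks.  Variables 1 to 4 hold the
-- x, y, κ, z of `Selected`, variable 3 later the current colour of the trail;
-- 5 to 8 are loop counters and 9 is scratch.

distᵉ δᵉ : Expr → Expr → Expr
distᵉ d e = (d ⊖ e) ⊕ (e ⊖ d)
δᵉ d e = lit 1 ⊖ distᵉ d e

cell-step cell degrees : Stmt
cell-step =
  1 [ var 5 , var 6 ]≔ arr 1 (var 5) (var 6)
                       ⊕ (lit 1 ⊖ (δᵉ (var 5) (var 7) ⊕ distᵉ (arr 0 (var 5) (var 7)) (var 6)))
cell = 1 [ var 5 , var 6 ]≔ lit 0 ⨟ for 7 cell-step
degrees = for 5 (for 6 cell)

cell-correct : ∀ s {n u κ} → vars s 0 ≡ n → vars s 5 ≡ u → vars s 6 ≡ κ →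
               arrs (run cell s) 1 u κ ≡ degree n (arrs s 0) u κ ×
               (∀ k l → ¬ (k ≡ u × l ≡ κ) → arrs (run cell s) 1 k l ≡ arrs s 1 k l)
cell-correct s {_} {u} {κ} refl refl refl =
  for-induction 7 cell-step (writeArr 1 u κ 0 s) I _
    (writeArr-same 1 u κ 0 s , λ k l → writeArr-other 1 u κ 0 s ∘ (_∘ proj₂))
    (λ m s′ _ s′₇ fr → step m s′ s′₇ (var= fr 5) (var= fr 6) (arr= fr 0 u m))
  where
  I : ℕ → Store → Set
  I m s′ = arrs s′ 1 u κ ≡ sumBelow m (λ v → slot (δ u v) (arrs s 0 u v) κ) ×
           (∀ k l → ¬ (k ≡ u × l ≡ κ) → arrs s′ 1 k l ≡ arrs s 1 k l)

  step : ∀ m s′ → vars s′ 7 ≡ m → vars s′ 5 ≡ u → vars s′ 6 ≡ κ → arrs s′ 0 u m ≡ arrs s 0 u m →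
         I m s′ → I (suc m) (writeVar 7 (suc m) (run cell-step s′))
  step m s′ s′₇ s′₅ s′₆ M= (here , there) rewrite s′₅ | s′₆ | s′₇ | M= =
    trans (writeArr-same 1 u κ _ s′)
      (cong₂ _+_ here (sym (slot-unfold u m (arrs s 0 u m) κ))) ,
    λ k l ne → trans (writeArr-other 1 u κ _ s′ (ne ∘ proj₂)) (there k l ne)

row-correct : ∀ s {n u} → vars s 0 ≡ n → vars s 5 ≡ u →
              (∀ κ → κ < n → arrs (run (for 6 cell) s) 1 u κ ≡ degree n (arrs s 0) u κ) ×
              (∀ k l → k ≢ u → arrs (run (for 6 cell) s) 1 k l ≡ arrs s 1 k l)
row-correct s {n} {u} refl refl =
  for-induction 6 cell s I _ ((λ _ ()) , λ _ _ _ → refl)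
    (λ m s′ _ s′₆ fr → step m s′ (cell-correct s′ (var= fr 0) (var= fr 5) s′₆) (arr= fr 0))
  where
  I : ℕ → Store → Set
  I m s′ = (∀ κ → κ < m → arrs s′ 1 u κ ≡ degree n (arrs s 0) u κ) ×
           (∀ k l → k ≢ u → arrs s′ 1 k l ≡ arrs s 1 k l)

  step : ∀ m s′ →
         arrs (run cell s′) 1 u m ≡ degree n (arrs s′ 0) u m ×
         (∀ k l → ¬ (k ≡ u × l ≡ m) → arrs (run cell s′) 1 k l ≡ arrs s′ 1 k l) →
         (∀ k l → arrs s′ 0 k l ≡ arrs s 0 k l) →
         I m s′ → I (suc m) (writeVar 6 (suc m) (run cell s′))
  step m s′ (here , there) M= (done , rest) =
    filled , λ k l k≢u → trans (there k l (k≢u ∘ proj₁)) (rest k l k≢u)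
    where
    filled : ∀ κ → κ < suc m → arrs (run cell s′) 1 u κ ≡ degree n (arrs s 0) u κ
    filled κ κ<1+m with κ ≟ m
    ... | yes refl = trans here (degree-cong n M= u m)
    ... | no  κ≢m  = trans (there u κ (κ≢m ∘ proj₂)) (done κ (≤∧≢⇒< (s≤s⁻¹ κ<1+m) κ≢m))

-- All loops run to `n`, so the table has one column more than there are colours.
degrees-correct : ∀ s {n} → vars s 0 ≡ n → ∀ u κ → u < n → κ < n →
                  arrs (run degrees s) 1 u κ ≡ degree n (arrs s 0) u κ
degrees-correct s {n} refl u κ u<n κ<n = for-induction 5 (for 6 cell) s I _ (λ _ _ ())
  (λ m s′ _ s′₅ fr → step m s′ (row-correct s′ (var= fr 0) s′₅) (arr= fr 0)) u κ u<n κ<n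
  where
  I : ℕ → Store → Set
  I m s′ = ∀ u κ → u < m → κ < n → arrs s′ 1 u κ ≡ degree n (arrs s 0) u κ

  step : ∀ m s′ →
         (∀ κ → κ < n → arrs (run (for 6 cell) s′) 1 m κ ≡ degree n (arrs s′ 0) m κ) ×
         (∀ k l → k ≢ m → arrs (run (for 6 cell) s′) 1 k l ≡ arrs s′ 1 k l) →
         (∀ k l → arrs s′ 0 k l ≡ arrs s 0 k l) →
         I m s′ → I (suc m) (writeVar 5 (suc m) (run (for 6 cell) s′))
  step m s′ (here , there) M= done u κ u<1+m κ<n with u ≟ m
  ... | no  u≢m  = trans (there u κ u≢m) (done u κ (≤∧≢⇒< (s≤s⁻¹ u<1+m) u≢m) κ<n)
  ... | yes refl = trans (here κ κ<n) (degree-cong n M= u κ)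

-- Exhaustive search for a starting point

record-choice choose search-z search-κ search-y search : Stmt
record-choice = 1 ≔ var 5 ⨟ 2 ≔ var 6 ⨟ 3 ≔ var 7 ⨟ 4 ≔ var 8

-- One of them vanishes iff variables 5 to 8 satisfy `Selected`.
repeated-at exchanged-at : Expr
repeated-at =
  arr 1 (var 6) (var 7) ⊕ (δᵉ (var 5) (var 8) ⊕
  (distᵉ (arr 0 (var 5) (var 8)) (var 7) ⊕ (lit 2 ⊖ arr 1 (var 5) (var 7))))
exchanged-at =
  arr 1 (var 6) (var 7) ⊕ (δᵉ (var 5) (var 8) ⊕
  (δᵉ (var 8) (var 6) ⊕ (arr 1 (var 8) (var 7) ⊕
  (distᵉ (arr 1 (var 5) (var 7)) (lit 1) ⊕
   (lit 2 ⊖ arr 1 (var 8) (arr 0 (var 5) (var 8)))))))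

choose   = unless repeated-at record-choice ⨟ unless exchanged-at record-choice
search-z = for 8 choose
search-κ = for 7 search-z
search-y = for 6 search-κ
search   = for 5 search-y

+≡0 : ∀ {m n} → m + n ≡ 0 → m ≡ 0 × n ≡ 0
+≡0 {m} eq = m+n≡0⇒m≡0 m eq , m+n≡0⇒n≡0 m eq

0+ : ∀ {m n} → m ≡ 0 → n ≡ 0 → m + n ≡ 0
0+ = cong₂ _+_

module _ {n : ℕ} {M : Matrix} (V : Valid n M) where

  private
    Choice : Store → Set
    Choice s = Selected n M (vars s 1) (vars s 2) (vars s 3) (vars s 4)

    Candidate : Store → Set
    Candidate s = Selected n M (vars s 5) (vars s 6) (vars s 7) (vars s 8)

    Tables : Store → Set
    Tables s = (∀ k l → arrs s 0 k l ≡ M k l) ×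
               (∀ u κ → u < n → κ < n → arrs s 1 u κ ≡ degree n M u κ)

    Bounds : Store → Set
    Bounds s = vars s 5 < n × vars s 6 < n × vars s 7 < n × vars s 8 < n

    module _ (s : Store) (tables : Tables s) (bounds : Bounds s) where

      x y κ z : ℕ
      x = vars s 5
      y = vars s 6
      κ = vars s 7
      z = vars s 8

      x< = proj₁ bounds
      y< = proj₁ (proj₂ bounds)
      κ< = proj₁ (proj₂ (proj₂ bounds))
      z< = proj₂ (proj₂ (proj₂ bounds))
      M= = proj₁ tables
      A= = proj₂ tables

      colour< : x ≢ z → M x z < n
      colour< x≢z = ≤-trans (bounded V x< z< x≢z) (m∸n≤m n 1)

      repeated-sound : ⟦ repeated-at ⟧ s ≡ 0 → Candidate s
      repeated-sound eq =
        let y-free , eq₁ = +≡0 eq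
            x≢z , eq₂ = +≡0 eq₁
            Mxz , 2≤ = +≡0 eq₂
        in  record
          { x<n = x< ; y<n = y< ; z<n = z< ; x≢z = δ≡0⇒≢ (trans (δ-unfold x z) x≢z)
          ; y-free = trans (sym (A= y κ y< κ<)) y-free
          ; kind = inj₁ (trans (sym (M= x z)) (dist≡0⇒≡ Mxz) ,
                         subst (2 ≤_) (A= x κ x< κ<) (m∸n≡0⇒m≤n 2≤)) }

      exchanged-sound : ⟦ exchanged-at ⟧ s ≡ 0 → Candidate s
      exchanged-sound eq =
        let y-free , eq₁ = +≡0 eq
            x≢z , eq₂ = +≡0 eq₁
            z≢y , eq₃ = +≡0 eq₂
            z-free , eq₄ = +≡0 eq₃
            x-once , 2≤ = +≡0 eq₄
            x≢z′ = δ≡0⇒≢ (trans (δ-unfold x z) x≢z)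
        in  record
          { x<n = x< ; y<n = y< ; z<n = z< ; x≢z = x≢z′
          ; y-free = trans (sym (A= y κ y< κ<)) y-free
          ; kind = inj₂ (δ≡0⇒≢ (trans (δ-unfold z y) z≢y) ,
                         trans (sym (A= z κ z< κ<)) z-free ,
                         trans (sym (A= x κ x< κ<)) (dist≡0⇒≡ x-once) ,
                         subst (2 ≤_) (trans (cong (arrs s 1 z) (M= x z)) (A= z (M x z) z< (colour< x≢z′)))
                           (m∸n≡0⇒m≤n 2≤)) }

      complete : Candidate s → ⟦ repeated-at ⟧ s ≡ 0 ⊎ ⟦ exchanged-at ⟧ s ≡ 0
      complete S with kind S
      ... | inj₁ (Mxz , 2≤) = inj₁
        (0+ (trans (A= y κ y< κ<) (y-free S))
        (0+ (trans (sym (δ-unfold x z)) (δ-≢ (x≢z S)))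
        (0+ (≡⇒dist≡0 (trans (M= x z) Mxz))
            (m≤n⇒m∸n≡0 (subst (2 ≤_) (sym (A= x κ x< κ<)) 2≤)))))
      ... | inj₂ (z≢y , z-free , x-once , 2≤) = inj₂
        (0+ (trans (A= y κ y< κ<) (y-free S))
        (0+ (trans (sym (δ-unfold x z)) (δ-≢ (x≢z S)))
        (0+ (trans (sym (δ-unfold z y)) (δ-≢ z≢y))
        (0+ (trans (A= z κ z< κ<) z-free)
        (0+ (≡⇒dist≡0 (trans (A= x κ x< κ<) x-once))
            (m≤n⇒m∸n≡0 (subst (2 ≤_)
              (sym (trans (cong (arrs s 1 z) (M= x z)) (A= z (M x z) z< (colour< (x≢z S))))) 2≤)))))))

    attempt : ∀ e s → (⟦ e ⟧ s ≡ 0 → Candidate s) → Choice s ⊎ ⟦ e ⟧ s ≡ 0 →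
              Choice (run (unless e record-choice) s)
    attempt e s sound g with ⟦ e ⟧ s
    attempt e s sound g         | zero  = sound refl
    attempt e s sound (inj₁ g)  | suc _ = g

    attempts : ∀ s → Tables s → Bounds s → Choice s ⊎ Candidate s →
               Choice (run choose s)
    attempts s tables bounds start with ⟦ repeated-at ⟧ s in eq
    -- `record-choice` leaves variables 5 to 8 alone, so if the second test succeeds as well, it
    -- records the same quadruple again.
    ... | zero = attempt exchanged-at (run record-choice s)
                   (exchanged-sound (run record-choice s) tables bounds)
                   (inj₁ (repeated-sound s tables bounds eq))
    ... | suc m = attempt exchanged-at s (exchanged-sound s tables bounds) (second start)
      where
      second : Choice s ⊎ Candidate s → Choice s ⊎ ⟦ exchanged-at ⟧ s ≡ 0
      second (inj₁ g) = inj₁ g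
      second (inj₂ S) with complete s tables bounds S
      ... | inj₁ eq′ = contradiction (trans (sym eq) eq′) 1+n≢0
      ... | inj₂ eq′ = inj₂ eq′

    module _ {x y κ z : ℕ} (κ< : κ < n) (S : Selected n M x y κ z) where

      tables-frame : ∀ {p s s′} {_ : KeepsArr 0 p} {_ : KeepsArr 1 p} →
                     Frame p s s′ → Tables s → Tables s′
      tables-frame {_} {_} {_} {k₀} {k₁} f (M= , A=) =
        (λ k l → trans (arr= f 0 {k₀} k l) (M= k l)) ,
        (λ u μ u< μ< → trans (arr= f 1 {k₁} u μ) (A= u μ u< μ<))

      candidate : ∀ s → vars s 5 ≡ x × vars s 6 ≡ y × vars s 7 ≡ κ → vars s 8 ≡ z → Candidate s
      candidate s (refl , refl , refl) refl = S

      find-z : ∀ s → vars s 0 ≡ n → Tables s → vars s 5 < n → vars s 6 < n → vars s 7 < n →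
               Choice s ⊎ (vars s 5 ≡ x × vars s 6 ≡ y × vars s 7 ≡ κ) → Choice (run search-z s)
      find-z s refl tables x< y< κ<′ = for-find 8 choose s Choice _ z (z<n S) _ (λ _ _ g → g) step
        where
        step : ∀ s′ → vars s′ 8 < n → Frame search-z s s′ →
               Choice s′ ⊎ ((vars s 5 ≡ x × vars s 6 ≡ y × vars s 7 ≡ κ) × vars s′ 8 ≡ z) →
               Choice (run choose s′)
        step s′ z< f start with var= f 5 | var= f 6 | var= f 7
        ... | p | q | r = attempts s′ (tables-frame f tables)
          (subst (_< n) (sym p) x< , subst (_< n) (sym q) y< , subst (_< n) (sym r) κ<′ , z<)
          ([ inj₁ , (λ ((e₅ , e₆ , e₇) , e₈) →
               inj₂ (candidate s′ (trans p e₅ , trans q e₆ , trans r e₇) e₈)) ]′ start)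

      find-κ : ∀ s → vars s 0 ≡ n → Tables s → vars s 5 < n → vars s 6 < n →
               Choice s ⊎ (vars s 5 ≡ x × vars s 6 ≡ y) → Choice (run search-κ s)
      find-κ s refl tables x< y< = for-find 7 search-z s Choice _ κ κ< _ (λ _ _ g → g) step
        where
        step : ∀ s′ → vars s′ 7 < n → Frame search-κ s s′ →
               Choice s′ ⊎ ((vars s 5 ≡ x × vars s 6 ≡ y) × vars s′ 7 ≡ κ) →
               Choice (run search-z s′)
        step s′ κ<′ f start with var= f 5 | var= f 6
        ... | p | q = find-z s′ (var= f 0) (tables-frame f tables)
          (subst (_< n) (sym p) x<) (subst (_< n) (sym q) y<) κ<′
          ([ inj₁ , (λ ((e₅ , e₆) , e₇) → inj₂ (trans p e₅ , trans q e₆ , e₇)) ]′ start)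

      find-y : ∀ s → vars s 0 ≡ n → Tables s → vars s 5 < n →
               Choice s ⊎ vars s 5 ≡ x → Choice (run search-y s)
      find-y s refl tables x< = for-find 6 search-κ s Choice _ y (y<n S) _ (λ _ _ g → g) step
        where
        step : ∀ s′ → vars s′ 6 < n → Frame search-y s s′ →
               Choice s′ ⊎ (vars s 5 ≡ x × vars s′ 6 ≡ y) → Choice (run search-κ s′)
        step s′ y< f start with var= f 5
        ... | p = find-κ s′ (var= f 0) (tables-frame f tables) (subst (_< n) (sym p) x<) y<
          ([ inj₁ , (λ (e₅ , e₆) → inj₂ (trans p e₅ , e₆)) ]′ start)

  -- The given candidate serves only to guarantee a success; the one recorded may be different. The
  -- four nested loops are the deepest in the program and set the exponent of the time bound.
  search-correct : ∀ s → vars s 0 ≡ n → Tables s → ∀ {x y κ z} → κ < n → Selected n M x y κ z →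
                   Choice (run search s)
  search-correct s refl tables {x} κ< S =
    -- The outermost loop has no enclosing counters, so its `E` is a trivially true equation.
    for-find 5 search-y s Choice (n ≡ n) x (x<n S) _ (λ _ _ g → g)
      (λ s′ x< f start → find-y κ< S s′ (var= f 0) (tables-frame κ< S f tables) x<
        ([ inj₁ , inj₂ ∘ proj₂ ]′ start))
      (inj₂ refl)

-- Painting an edge and initialising the marks

paint : ℕ → ℕ → ℕ → Stmt
paint i j k = 0 [ var i , var j ]≔ var k ⨟ 0 [ var j , var i ]≔ var k

paint-recoloured : ∀ i j k s →
  Recoloured (vars s i) (vars s j) (vars s k) (arrs s 0) (arrs (run (paint i j k) s) 0)
paint-recoloured i j k s = record
  { forth = writeArr-keeps 0 z x ν s₁ {0} {x} {z} (writeArr-same 0 x z ν s)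
  ; back = writeArr-same 0 z x ν s₁
  ; elsewhere = λ a b ≢xz ≢zx →
      trans (writeArr-other 0 z x ν s₁ {0} {a} {b} (≢zx ∘ proj₂)) (writeArr-other 0 x z ν s (≢xz ∘ proj₂)) }
  where
  x z ν : ℕ
  x = vars s i
  z = vars s j
  ν = vars s k

  s₁ : Store
  s₁ = writeArr 0 x z ν s

-- Array 2 serves as a vector stored in column 0. It has to be cleared because the initial store may
-- hold anything there.
unmark-all init-marks : Stmt
unmark-all = for 5 (2 [ var 5 , lit 0 ]≔ lit 0)
init-marks = unmark-all ⨟ 2 [ var 1 , lit 0 ]≔ lit 1 ⨟ 2 [ var 2 , lit 0 ]≔ lit 1

unmark-all-correct : ∀ s v → v < vars s 0 → arrs (run unmark-all s) 2 v 0 ≡ 0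
unmark-all-correct s = for-induction 5 (2 [ var 5 , lit 0 ]≔ lit 0) s I _ (λ _ ())
  (λ m s′ _ s′₅ _ → step m s′ s′₅)
  where
  I : ℕ → Store → Set
  I m s′ = ∀ v → v < m → arrs s′ 2 v 0 ≡ 0

  step : ∀ m s′ → vars s′ 5 ≡ m → I m s′ → I (suc m) (writeArr 2 (vars s′ 5) 0 0 s′)
  step m s′ refl done v v<1+m = at (v ≟ m)
    where
    at : Dec (v ≡ m) → arrs (writeArr 2 m 0 0 s′) 2 v 0 ≡ 0
    at (yes refl) = writeArr-same 2 m 0 0 s′
    at (no  v≢m)  = writeArr-keeps 2 m 0 0 s′ (done v (≤∧≢⇒< (s≤s⁻¹ v<1+m) v≢m))

module _ (s : Store) {x y : ℕ} (s₁ : vars s 1 ≡ x) (s₂ : vars s 2 ≡ y) where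

  private
    t : Store
    t = run unmark-all s

    t₁ : vars t 1 ≡ x
    t₁ = trans (var= (run-frame unmark-all s) 1) s₁

    t₂ : vars t 2 ≡ y
    t₂ = trans (var= (run-frame unmark-all s) 2) s₂

    t′ : Store
    t′ = writeArr 2 (vars t 1) 0 1 t

  init-marks-y : arrs (run init-marks s) 2 y 0 ≡ 1
  init-marks-y = subst (λ v → arrs (writeArr 2 (vars t 2) 0 1 t′) 2 v 0 ≡ 1) t₂
    (writeArr-same 2 (vars t 2) 0 1 t′)

  init-marks-x : x ≢ y → arrs (run init-marks s) 2 x 0 ≡ 1
  init-marks-x x≢y =
    trans (writeArr-other 2 (vars t 2) 0 1 t′ {2} {x} {0} (λ (_ , x≡ , _) → x≢y (trans x≡ t₂)))
      (subst (λ v → arrs t′ 2 v 0 ≡ 1) t₁ (writeArr-same 2 (vars t 1) 0 1 t))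

  init-marks-other : ∀ v → v < vars s 0 → v ≢ x → v ≢ y → arrs (run init-marks s) 2 v 0 ≡ 0
  init-marks-other v v<n v≢x v≢y =
    trans (writeArr-other 2 (vars t 2) 0 1 t′ {2} {v} {0} (λ (_ , v≡ , _) → v≢y (trans v≡ t₂)))
      (trans (writeArr-other 2 (vars t 1) 0 1 t {2} {v} {0} (λ (_ , v≡ , _) → v≢x (trans v≡ t₁)))
        (unmark-all-correct s v v<n))

-- Following the trail

stuck : Expr
-- Array 1 still holds the degrees from before the trail, which are the ones compared in
-- `trail-continues` and `column-≤`. The value is zero when the trail has not ended and can leave
-- through the vertex in variable 5.
stuck = (arr 1 (var 2) (var 3) ⊖ arr 1 (var 1) (var 3)) ⊕
        (arr 2 (var 5) (lit 0) ⊕ distᵉ (arr 0 (var 1) (var 5)) (var 3))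

swap-colours advance pass trail : Stmt
swap-colours =
  9 ≔ arr 0 (var 2) (var 5) ⨟ paint 1 5 9 ⨟ paint 2 5 3 ⨟
  2 [ var 5 , lit 0 ]≔ lit 1 ⨟ 3 ≔ var 9
advance = unless stuck swap-colours
pass    = for 5 advance
trail   = for 6 pass

module _ {n : ℕ} {M₁ : Matrix} {x y κ : ℕ} (x<n : x < n) (y<n : y < n) (x≢y : x ≢ y)
         (2≤x : 2 ≤ degree n M₁ x κ) (y≡0 : degree n M₁ y κ ≡ 0) where

  private
    On : Store → Set
    On s = Trail n M₁ x y κ (arrs s 0) (λ v → arrs s 2 v 0) (vars s 3)

    Done : Store → Set
    Done s = degree n M₁ x (vars s 3) < degree n M₁ y (vars s 3)

    unmarked : Store → ℕ
    unmarked s = sumBelow n λ v → 1 ∸ arrs s 2 v 0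

    Setting : Store → Set
    Setting s = vars s 0 ≡ n × vars s 1 ≡ x × vars s 2 ≡ y ×
                (∀ u μ → u < n → μ < n → arrs s 1 u μ ≡ degree n M₁ u μ)

    setting-frame : ∀ {p s s′} {_ : KeepsVar 0 p} {_ : KeepsVar 1 p} {_ : KeepsVar 2 p}
                    {_ : KeepsArr 1 p} → Frame p s s′ → Setting s → Setting s′
    setting-frame {_} {_} {_} {k₀} {k₁} {k₂} {a₁} f (s₀ , s₁ , s₂ , A=) =
      trans (var= f 0 {k₀}) s₀ , trans (var= f 1 {k₁}) s₁ , trans (var= f 2 {k₂}) s₂ ,
      λ u μ u< μ< → trans (arr= f 1 {a₁} u μ) (A= u μ u< μ<)

    Next : Store → ℕ → Set
    Next s w = arrs s 2 w 0 ≡ 0 × arrs s 0 x w ≡ vars s 3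

    next : ∀ s → On s → ¬ Done s → ∃[ w ] (w < n × Next s w)
    next s T ¬done = trail-continues x<n y<n x≢y T 2≤x y≡0 (≮⇒≥ ¬done)

    swap-on : ∀ s → vars s 1 ≡ x → vars s 2 ≡ y → vars s 5 < n → Next s (vars s 5) → On s →
              On (run swap-colours s)
    swap-on s refl refl w<n (free , Mxw) T =
      trail-step x<n y<n x≢y T w<n free Mxw
        (paint-recoloured 1 5 9 s₁) (paint-recoloured 2 5 3 s₂)
        (λ eq → 1+n≢0 (trans (sym (writeArr-same 2 (vars s 5) 0 1 s₃)) eq))
        (λ v v≢w → writeArr-other 2 (vars s 5) 0 1 s₃ {2} {v} {0} (v≢w ∘ proj₁ ∘ proj₂))
      where
      s₁ s₂ s₃ : Store
      s₁ = run (9 ≔ arr 0 (var 2) (var 5)) s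
      s₂ = run (paint 1 5 9) s₁
      s₃ = run (paint 2 5 3) s₂

    swap-unmarked : ∀ s → vars s 5 < n → arrs s 2 (vars s 5) 0 ≡ 0 →
                    unmarked (run swap-colours s) < unmarked s
    swap-unmarked s w<n free = ≤-reflexive (trans (+-comm 1 _)
      (trans (sum-replace n (vars s 5) w<n
               (λ v _ v≢w → cong (1 ∸_) (writeArr-other 2 (vars s 5) 0 1 s₃ {2} {v} {0} (v≢w ∘ proj₁ ∘ proj₂)))
               (trans (cong (λ k → 1 ∸ k + 1) (writeArr-same 2 (vars s 5) 0 1 s₃))
                 (cong (λ k → 1 ∸ k + 0) (sym free))))
        (+-identityʳ _)))
      where
      s₃ : Store
      s₃ = run (paint 2 5 3) (run (paint 1 5 9) (run (9 ≔ arr 0 (var 2) (var 5)) s))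

    cur<n : ∀ s → On s → vars s 3 < n
    cur<n s T = ≤-trans (cur-bounded T) (m∸n≤m n 1)

    stuck-zero : ∀ s → Setting s → On s → ⟦ stuck ⟧ s ≡ 0 → ¬ Done s × Next s (vars s 5)
    stuck-zero s (refl , refl , refl , A=) T eq =
      let deg , rest = +≡0 eq
          free , col = +≡0 {arrs s 2 (vars s 5) 0} rest
      in  (λ done → <⇒≱ done
            (subst₂ _≤_ (A= y _ y<n (cur<n s T)) (A= x _ x<n (cur<n s T)) (m∸n≡0⇒m≤n deg))) ,
          free , dist≡0⇒≡ col

    zero-stuck : ∀ s → Setting s → On s → ¬ Done s → Next s (vars s 5) → ⟦ stuck ⟧ s ≡ 0
    zero-stuck s (refl , refl , refl , A=) T ¬done (free , col) =
      0+ (m≤n⇒m∸n≡0 (subst₂ _≤_ (sym (A= y _ y<n (cur<n s T))) (sym (A= x _ x<n (cur<n s T)))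
            (≮⇒≥ ¬done)))
         (0+ free (≡⇒dist≡0 col))

  -- An unfinished trail has a continuing vertex `w` ahead of the counter at the start of the pass.
  -- It remains usable until a step is made at an earlier vertex or the counter reaches it; in both
  -- events `unmarked` drops.
  pass-progress : ∀ f s → Setting s → On s → Done s ⊎ unmarked s ≤ f →
                  On (run pass s) × (Done (run pass s) ⊎ unmarked (run pass s) < f)
  pass-progress f s setting@(refl , _) T bound =
    conclude (for-induction 5 advance s I _ (T , start bound) step)
    where
    Progress : ℕ → Store → Set
    Progress m s′ = unmarked s′ < f ⊎
                    (unmarked s′ ≤ f × ∃[ w ] (m ≤ w × w < n × Next s′ w))

    I : ℕ → Store → Set
    I m s′ = On s′ × (Done s′ ⊎ Progress m s′)

    start : Done s ⊎ unmarked s ≤ f → Done s ⊎ Progress 0 s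
    start (inj₁ done) = inj₁ done
    start (inj₂ le) with degree n M₁ x (vars s 3) <? degree n M₁ y (vars s 3)
    ... | yes done = inj₁ done
    ... | no ¬done =
      let w , w<n , nx = next s T ¬done in inj₂ (inj₂ (le , w , z≤n , w<n , nx))

    conclude : I n (run pass s) → On (run pass s) × (Done (run pass s) ⊎ unmarked (run pass s) < f)
    conclude (T′ , inj₁ done)        = T′ , inj₁ done
    conclude (T′ , inj₂ (inj₁ lt))   = T′ , inj₂ lt
    conclude (T′ , inj₂ (inj₂ (_ , w , n≤w , w<n , _))) = contradiction n≤w (<⇒≱ w<n)

    step : ∀ m s′ → m < n → vars s′ 5 ≡ m → Frame pass s s′ → I m s′ →
           I (suc m) (writeVar 5 (suc m) (run advance s′))
    step m s′ m<n refl fr (T′ , pr) with setting-frame fr setting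
    ... | setting′ with ⟦ stuck ⟧ s′ in eq
    ... | zero = swap-on s′ (proj₁ (proj₂ setting′)) (proj₁ (proj₂ (proj₂ setting′))) m<n nx T′ ,
                 inj₂ (inj₁ (≤-trans (swap-unmarked s′ m<n (proj₁ nx)) (not-more pr)))
      where
      nx : Next s′ (vars s′ 5)
      nx = proj₂ (stuck-zero s′ setting′ T′ eq)

      not-more : Done s′ ⊎ Progress m s′ → unmarked s′ ≤ f
      not-more (inj₁ done)             = contradiction done (proj₁ (stuck-zero s′ setting′ T′ eq))
      not-more (inj₂ (inj₁ lt))        = <⇒≤ lt
      not-more (inj₂ (inj₂ (le , _)))  = le
    ... | suc k = T′ , later pr
      where
      later : Done s′ ⊎ Progress m s′ → Done s′ ⊎ Progress (suc m) s′
      later (inj₁ done)      = inj₁ done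
      later (inj₂ (inj₁ lt)) = inj₂ (inj₁ lt)
      later (inj₂ (inj₂ (le , w , m≤w , w<n , nx)))
        with m ≟ w | degree n M₁ x (vars s′ 3) <? degree n M₁ y (vars s′ 3)
      ... | _ | yes done = inj₁ done
      ... | no m≢w | no _ = inj₂ (inj₂ (le , w , ≤∧≢⇒< m≤w m≢w , w<n , nx))
      ... | yes refl | no ¬done =
        contradiction (trans (sym eq) (zero-stuck s′ setting′ T′ ¬done nx)) 1+n≢0

  -- After `n` passes an unfinished trail would have no unmarked vertex left, while
  -- `trail-continues` still provides one.
  trail-correct : ∀ s → Setting s → On s → On (run trail s) × Done (run trail s)
  trail-correct s setting@(refl , _) T = conclude (for-induction 6 pass s I _ (T , inj₂ start) step)
    where
    I : ℕ → Store → Set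
    I m s′ = On s′ × (Done s′ ⊎ unmarked s′ ≤ n ∸ m)

    start : unmarked s ≤ n
    start = begin
      unmarked s            ≤⟨ sum-mono n (λ v _ → m∸n≤m 1 (arrs s 2 v 0)) ⟩
      sumBelow n (λ _ → 1)  ≡⟨ sum-const n 1 ⟩
      n * 1                 ≡⟨ *-identityʳ n ⟩
      n                     ∎
      where open ≤-Reasoning

    step : ∀ m s′ → m < n → vars s′ 6 ≡ m → Frame trail s s′ → I m s′ →
           I (suc m) (writeVar 6 (suc m) (run pass s′))
    step m s′ _ refl fr (T′ , bound) with pass-progress (n ∸ m) s′ (setting-frame fr setting) T′ bound
    ... | T″ , inj₁ done = T″ , inj₁ done
    ... | T″ , inj₂ lt   = T″ , inj₂ (≤-trans (<⇒≤pred lt) (≤-reflexive (pred[m∸n]≡m∸[1+n] n m)))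

    conclude : I n (run trail s) → On (run trail s) × Done (run trail s)
    conclude (T′ , inj₁ done) = T′ , done
    conclude (T′ , inj₂ le)
      with degree n M₁ x (vars (run trail s) 3) <? degree n M₁ y (vars (run trail s) 3)
    ... | yes done = T′ , done
    ... | no ¬done =
      let w , w<n , free , _ = next (run trail s) T′ ¬done
      in  contradiction (≤-trans le (≤-reflexive (n∸n≡0 n)))
            (<⇒≱ (≤-trans (s≤s z≤n) (sum-mono-< n {λ _ → 0} w w<n (λ _ _ → z≤n)
                    (≤-reflexive (cong (1 ∸_) (sym free))))))

-- The complete program

improve : Stmt
-- The degrees are tabulated again after painting, because the trail compares degrees in the painted
-- matrix.
improve = degrees ⨟ search ⨟ paint 1 4 3 ⨟ degrees ⨟ init-marks ⨟ trail

run-six : ∀ p q r t u v s →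
          run (p ⨟ q ⨟ r ⨟ t ⨟ u ⨟ v) s ≡ run v (run u (run t (run r (run q (run p s)))))
run-six p q r t u v s = refl

∉-ends : ∀ {n x} {e : Edge n} (x<n : x < n) → fromℕ< x<n ∉ᵉ e → toℕ (lo e) ≢ x × toℕ (hi e) ≢ x
∉-ends {e = e} x<n x∉e =
  (λ eq → x∉e (inj₁ (toℕ-injective (trans (toℕ-fromℕ< x<n) (sym eq))))) ,
  (λ eq → x∉e (inj₂ (toℕ-injective (trans (toℕ-fromℕ< x<n) (sym eq)))))

frame : ∀ {p s s′} → s′ ≡ run p s → Frame p s s′
frame {p} {s} refl = run-frame p s

-- The stores between the phases are variables, so that no run is unfolded.
module _ {n : ℕ} (2∣n : 2 ∣ n) (c : Coloring n) (opt : LocallyOptimal c) (¬proper : ¬ IsOneFactorization c)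
         {s s₁ s₂ s₃ s₄ s₅ s₆ : Store} (holds : Holds c s)
         (e₁ : s₁ ≡ run degrees s) (e₂ : s₂ ≡ run search s₁) (e₃ : s₃ ≡ run (paint 1 4 3) s₂)
         (e₄ : s₄ ≡ run degrees s₃) (e₅ : s₅ ≡ run init-marks s₄) (e₆ : s₆ ≡ run trail s₅) where

  private
    M M₁ : Matrix
    M  = arrs s 0
    M₁ = arrs s₅ 0

    f₁ : Frame degrees s s₁
    f₁ = frame e₁

    f₂ : Frame search s₁ s₂
    f₂ = frame e₂

    f₃ : Frame (paint 1 4 3) s₂ s₃
    f₃ = frame e₃

    f₄ : Frame degrees s₃ s₄
    f₄ = frame e₄

    f₅ : Frame init-marks s₄ s₅
    f₅ = frame e₅

    f₆ : Frame trail s₅ s₆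
    f₆ = frame e₆

    E : Encodes c M
    E = record { colour = Holds.colour holds ; mirror = Holds.mirror holds }

    V : Valid n M
    V = encodes-valid E

    size₁ : vars s₁ 0 ≡ n
    size₁ = trans (var= f₁ 0) (Holds.size holds)

    size₃ : vars s₃ 0 ≡ n
    size₃ = trans (var= f₃ 0) (trans (var= f₂ 0) size₁)

    size₄ : vars s₄ 0 ≡ n
    size₄ = trans (var= f₄ 0) size₃

    size₅ : vars s₅ 0 ≡ n
    size₅ = trans (var= f₅ 0) size₄

    x y κ z : ℕ
    x = vars s₂ 1
    y = vars s₂ 2
    κ = vars s₂ 3
    z = vars s₂ 4

    S : Selected n M x y κ z
    S = subst (λ t → Selected n M (vars t 1) (vars t 2) (vars t 3) (vars t 4)) (sym e₂)
      (let u , u<n , μ , μ< , 2≤ = repeated-colour E ¬proper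
           _ , _ , _ , _ , S₀ = selection V (locallyOptimal-matrix E opt) 2∣n u<n μ< 2≤
       in  search-correct V s₁ size₁
             (arr= f₁ 0 ,
              subst (λ t → ∀ u κ → u < n → κ < n → arrs t 1 u κ ≡ degree n M u κ) (sym e₁)
                (degrees-correct s (Holds.size holds)))
             (≤-trans (κ-bounded V S₀) (m∸n≤m n 1)) S₀)

    x≢y : x ≢ y
    x≢y = selected-distinct V S

    M₁≡ : ∀ i j → M₁ i j ≡ arrs s₃ 0 i j
    M₁≡ i j = trans (arr= f₅ 0 i j) (arr= f₄ 0 i j)

    painted : Recoloured x z κ M M₁
    painted = record
      { forth = trans (M₁≡ x z) (forth r)
      ; back = trans (M₁≡ z x) (back r)
      ; elsewhere = λ i j ≢xz ≢zx → trans (M₁≡ i j)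
          (trans (elsewhere r i j ≢xz ≢zx) (trans (arr= f₂ 0 i j) (arr= f₁ 0 i j))) }
      where
      r : Recoloured x z κ (arrs s₂ 0) (arrs s₃ 0)
      r = subst (λ t → Recoloured x z κ (arrs s₂ 0) (arrs t 0)) (sym e₃) (paint-recoloured 1 4 3 s₂)

    x₄ : vars s₄ 1 ≡ x
    x₄ = trans (var= f₄ 1) (var= f₃ 1)

    y₄ : vars s₄ 2 ≡ y
    y₄ = trans (var= f₄ 2) (var= f₃ 2)

    x₅ : vars s₅ 1 ≡ x
    x₅ = trans (var= f₅ 1) x₄

    y₅ : vars s₅ 2 ≡ y
    y₅ = trans (var= f₅ 2) y₄

    κ₅ : vars s₅ 3 ≡ κ
    κ₅ = trans (var= f₅ 3) (trans (var= f₄ 3) (var= f₃ 3))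

    tables : ∀ u μ → u < n → μ < n → arrs s₅ 1 u μ ≡ degree n M₁ u μ
    tables u μ u<n μ<n =
      trans (arr= f₅ 1 u μ)
        (trans (subst (λ t → arrs t 1 u μ ≡ degree n (arrs s₃ 0) u μ) (sym e₄)
                 (degrees-correct s₃ size₃ u μ u<n μ<n))
          (degree-cong n (λ i j → sym (M₁≡ i j)) u μ))

    start : Trail n M₁ x y κ M₁ (λ v → arrs s₅ 2 v 0) (vars s₅ 3)
    start = subst₂ (λ t μ → Trail n M₁ x y κ M₁ (λ v → arrs t 2 v 0) μ) (sym e₅) (sym κ₅)
      (trail-start (x<n S) (y<n S) x≢y (recoloured-valid V (κ-bounded V S) painted) (κ-bounded V S)
        (init-marks-x s₄ x₄ y₄ x≢y) (init-marks-y s₄ x₄ y₄)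
        (λ v v<n → init-marks-other s₄ x₄ y₄ v (≤-trans v<n (≤-reflexive (sym size₄)))))

    finish : Trail n M₁ x y κ (arrs s₆ 0) (λ v → arrs s₆ 2 v 0) (vars s₆ 3) ×
             degree n M₁ x (vars s₆ 3) < degree n M₁ y (vars s₆ 3)
    finish = subst
      (λ t → Trail n M₁ x y κ (arrs t 0) (λ v → arrs t 2 v 0) (vars t 3) ×
             degree n M₁ x (vars t 3) < degree n M₁ y (vars t 3))
      (sym e₆)
      (trail-correct (x<n S) (y<n S) x≢y (κ-twice V S painted) (y-still-free V S painted)
        s₅ (size₅ , x₅ , y₅ , tables) start)

    V₆ : Valid n (arrs s₆ 0)
    V₆ = valid (proj₁ finish)

    E₆ : Encodes (decode V₆) (arrs s₆ 0)
    E₆ = decode-encodes V₆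

    agree : ∀ e → fromℕ< (x<n S) ∉ᵉ e → fromℕ< (y<n S) ∉ᵉ e → decode V₆ e ≡ c e
    agree e x∉e y∉e =
      let lo≢x , hi≢x = ∉-ends {e = e} (x<n S) x∉e
          lo≢y , hi≢y = ∉-ends {e = e} (y<n S) y∉e
      in  toℕ-injective
            (trans (sym (colour E₆ e))
              (trans (untouched (proj₁ finish) _ _ lo≢x lo≢y hi≢x hi≢y)
                (trans (elsewhere painted _ _ (lo≢x ∘ proj₁) (hi≢x ∘ proj₂)) (colour E e))))

  phases-correct : OutputsImprovement c s₆
  phases-correct = record
    { x = fromℕ< (x<n S) ; y = fromℕ< (y<n S) ; c′ = decode V₆
    ; improvement = record
        { distinct = λ eq → x≢y
            (trans (sym (toℕ-fromℕ< (x<n S))) (trans (cong toℕ eq) (toℕ-fromℕ< (y<n S))))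
        ; agrees   = agree
        ; improves = subst₂ _<_ (sym (Ψ-energy E₆)) (sym (Ψ-energy E))
                       (selected-improves V S painted (proj₁ finish) (proj₂ finish)) }
    ; x-stored = trans (var= f₆ 1) (trans x₅ (sym (toℕ-fromℕ< (x<n S))))
    ; y-stored = trans (var= f₆ 2) (trans y₅ (sym (toℕ-fromℕ< (y<n S))))
    ; c′-stored = record
        { size = trans (var= f₆ 0) size₅ ; colour = colour E₆ ; mirror = mirror E₆ }
    }

improve-correct : ∀ {n} → 2 ∣ n → ∀ (c : Coloring n) → LocallyOptimal c → ¬ IsOneFactorization c →
                  ∀ s → Holds c s → OutputsImprovement c (run improve s)
improve-correct 2∣n c opt ¬proper s holds = subst (OutputsImprovement c)
  (sym (run-six degrees search (paint 1 4 3) degrees init-marks trail s))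
  (phases-correct 2∣n c opt ¬proper holds refl refl refl refl refl refl)

-- A store for a given colouring, and the theorem

extend : ∀ {n} → (Fin n → Fin n → ℕ) → Matrix
extend {n} f i j with i <? n | j <? n
... | yes i<n | yes j<n = f (fromℕ< i<n) (fromℕ< j<n)
-- An arbitrary default: `Holds` speaks only of entries that belong to edges.
... | _       | _       = 0

extend-toℕ : ∀ {n} (f : Fin n → Fin n → ℕ) u v → extend f (toℕ u) (toℕ v) ≡ f u v
extend-toℕ {n} f u v with toℕ u <? n | toℕ v <? n
... | yes u<n | yes v<n = cong₂ f (fromℕ<-toℕ u u<n) (fromℕ<-toℕ v v<n)
... | yes _   | no  v≮n = contradiction (toℕ<n v) v≮n
... | no  u≮n | _       = contradiction (toℕ<n u) u≮n

pair-colour : ∀ {n} → Coloring n → Fin n → Fin n → ℕ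
pair-colour c u v with u Fin.<? v | v Fin.<? u
... | yes u<v | _       = toℕ (c (mkEdge u v u<v))
... | no _    | yes v<u = toℕ (c (mkEdge v u v<u))
... | no _    | no _    = 0

pair-colour-edge : ∀ {n} (c : Coloring n) e → pair-colour c (lo e) (hi e) ≡ toℕ (c e)
pair-colour-edge c e with lo e Fin.<? hi e
... | yes _  = refl
... | no lo≮hi = contradiction (lo<hi e) lo≮hi

pair-colour-mirror : ∀ {n} (c : Coloring n) e → pair-colour c (hi e) (lo e) ≡ toℕ (c e)
pair-colour-mirror c e with hi e Fin.<? lo e | lo e Fin.<? hi e
... | yes hi<lo | _        = contradiction hi<lo (<-asym (lo<hi e))
... | no _      | yes _    = refl
... | no _      | no lo≮hi = contradiction (lo<hi e) lo≮hi

store-of : ∀ {n} → Coloring n → Store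
store-of {n} c = mkStore (λ _ → n) (λ _ → extend (pair-colour c))

store-of-holds : ∀ {n} (c : Coloring n) → Holds c (store-of c)
store-of-holds c = record
  { size   = refl
  ; colour = λ e → trans (extend-toℕ (pair-colour c) (lo e) (hi e)) (pair-colour-edge c e)
  ; mirror = λ e → trans (extend-toℕ (pair-colour c) (hi e) (lo e)) (pair-colour-mirror c e)
  }

-- With no vertices every colouring is vacuously proper. This supplies the positivity on which the
-- time bound rests.
nonempty : ∀ {n} {c : Coloring n} → ¬ IsOneFactorization c → NonZero n
nonempty {zero}  ¬proper = contradiction (λ ()) ¬proper
nonempty {suc n} ¬proper = _

theorem3 : (∀ (n : ℕ) → 2 ∣ n →
    ∀ (c : Coloring n) → LocallyOptimal c → ¬ IsOneFactorization c →
    ∃[ x ] ∃[ y ] ∃[ c′ ] TwoVertexImprovement c x y c′)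
    ×
    (∃[ p ] ∃[ a ] ∃[ k ]
    (∀ (n : ℕ) → 2 ∣ n →
    ∀ (c : Coloring n) → LocallyOptimal c → ¬ IsOneFactorization c →
    ∀ (s : Store) → Holds c s →
    ∃[ t ] ∃[ s′ ]
    (⟨ p , s ⟩⇓[ t ] s′ × t ≤ a * n ^ k × OutputsImprovement c s′)))
theorem3 =
  (λ n 2∣n c opt ¬proper →
    _ , _ , _ , OutputsImprovement.improvement
      (improve-correct 2∣n c opt ¬proper (store-of c) (store-of-holds c))) ,
  compile improve , factor improve , depth improve ,
  λ n 2∣n c opt ¬proper s holds →
    -- The two blanks are `KeepsVar 0 improve` and `KeepsCounters improve`, which hold by
    -- computation.
    let t , halts , t≤ = compile-runs n {{nonempty {c = c} ¬proper}} improve _ _ s (Holds.size holds)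
    in  t , run improve s , halts , t≤ , improve-correct 2∣n c opt ¬proper s holds
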